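{- The class of $\overline{K_{1,3}+2P_1}$-free chordal graphs has bounded clique-width.
   Context: All graphs are finite, simple and undirected. $G$ is $H$-free if it has no induced subgraph isomorphic to $H$. A graph is chordal if it contains no induced cycle $C_r$ with $r\geq 4$. $K_{1,3}$ is the claw, $P_1$ the one-vertex graph, $+$ denotes disjoint union, $2P_1$ two isolated vertices, and $\overline{G}$ the complement of $G$. The clique-width of a graph $G$ is the minimum number $k$ of labels needed to construct $G$ using the operations: create a single vertex with label $i$; take the disjoint union of two labelled graphs; add all edges between vertices of label $i$ and vertices of label $j$ ($i\neq j$); rename label $i$ to $j$. A class of graphs has bounded clique-width if there is a constant $c$ such that every graph in the class has clique-width at most $c$. -}

module Defs where

open import Data.Nat using (ℕ; zero; suc; _+_; _≤_; _≡ᵇ_)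
open import Data.Bool using (Bool; true; false; _∧_; _∨_; not; if_then_else_)
open import Data.Fin using (Fin; toℕ; splitAt)
import Data.Fin as Fin
open import Data.Sum using (_⊎_; inj₁; inj₂)
open import Data.Product using (Σ; _×_; ∃)
open import Relation.Binary.PropositionalEquality using (_≡_; _≢_)
open import Relation.Nullary using (¬_)
open import Relation.Nullary.Decidable using (⌊_⌋)
open import Function.Definitions using (Injective)

record Graph : Set where
  field
    n      : ℕ
    adj    : Fin n → Fin n → Bool
    irrefl : ∀ i → adj i i ≡ false
    sym    : ∀ i j → adj i j ≡ adj j i
open Graph public

-- G contains an induced subgraph isomorphic to the graph on Fin k with adjacency h
-- (h is assumed to be a simple graph's adjacency; see the patterns below).
HasInduced : (k : ℕ) → (Fin k → Fin k → Bool) → Graph → Set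
HasInduced k h G =
  Σ (Fin k → Fin (n G)) λ f → Injective _≡_ _≡_ f × (∀ i j → h i j ≡ adj G (f i) (f j))

Free : (k : ℕ) → (Fin k → Fin k → Bool) → Graph → Set
Free k h G = ¬ HasInduced k h G

cycleAdj : (r : ℕ) → Fin r → Fin r → Bool
cycleAdj r i j =
  (suc (toℕ i) ≡ᵇ toℕ j) ∨ (suc (toℕ j) ≡ᵇ toℕ i)
  ∨ ((toℕ i ≡ᵇ 0) ∧ (suc (toℕ j) ≡ᵇ r))
  ∨ ((toℕ j ≡ᵇ 0) ∧ (suc (toℕ i) ≡ᵇ r))

Chordal : Graph → Set
Chordal G = ∀ r → 4 ≤ r → Free r (cycleAdj r) G

claw2P1Adj : Fin 6 → Fin 6 → Bool
claw2P1Adj i j =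
  ((toℕ i ≡ᵇ 0) ∧ ((1 ≡ᵇ toℕ j) ∨ (2 ≡ᵇ toℕ j) ∨ (3 ≡ᵇ toℕ j)))
  ∨ ((toℕ j ≡ᵇ 0) ∧ ((1 ≡ᵇ toℕ i) ∨ (2 ≡ᵇ toℕ i) ∨ (3 ≡ᵇ toℕ i)))

coClaw2P1Adj : Fin 6 → Fin 6 → Bool
coClaw2P1Adj i j = not (toℕ i ≡ᵇ toℕ j) ∧ not (claw2P1Adj i j)

data CWExpr (k : ℕ) : ℕ → Set where
  vtx     : Fin k → CWExpr k 1
  union   : ∀ {m p} → CWExpr k m → CWExpr k p → CWExpr k (m + p)
  join    : ∀ {m} (i j : Fin k) → i ≢ j → CWExpr k m → CWExpr k m
  relabel : ∀ {m} (i j : Fin k) → CWExpr k m → CWExpr k m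

infix 4 _==_
_==_ : ∀ {k} → Fin k → Fin k → Bool
a == b = ⌊ a Fin.≟ b ⌋

label : ∀ {k m} → CWExpr k m → Fin m → Fin k
label (vtx c) _ = c
label (union {m} e₁ e₂) v with splitAt m v
... | inj₁ u = label e₁ u
... | inj₂ u = label e₂ u
label (join i j _ e) v = label e v
label (relabel i j e) v = if label e v == i then j else label e v

edge : ∀ {k m} → CWExpr k m → Fin m → Fin m → Bool
edge (vtx c) _ _ = false
edge (union {m} e₁ e₂) u v with splitAt m u | splitAt m v
... | inj₁ a | inj₁ b = edge e₁ a b
... | inj₂ a | inj₂ b = edge e₂ a b
... | inj₁ _ | inj₂ _ = false
... | inj₂ _ | inj₁ _ = false
edge (join i j _ e) u v =
  edge e u v ∨ ((label e u == i) ∧ (label e v == j)) ∨ ((label e u == j) ∧ (label e v == i))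
edge (relabel i j e) u v = edge e u v

-- G has clique-width at most k: G is empty, or some k-expression builds a graph
-- isomorphic to G (π is an injective, hence bijective, map Fin n → Fin n).
CWAtMost : ℕ → Graph → Set
CWAtMost k G =
  n G ≡ 0 ⊎
  Σ (CWExpr k (n G)) λ e → Σ (Fin (n G) → Fin (n G)) λ π →
    Injective _≡_ _≡_ π × (∀ u v → edge e u v ≡ adj G (π u) (π v))

{-# OPTIONS --safe #-}
module Submission where

-- Clique-width is bounded by exhibiting a binary tree of vertex subsets, each of which leaves a
-- bounded number of neighbourhoods outside itself. The forbidden graph is K₅ with a further vertex
-- adjacent to exactly two of its vertices, so a vertex with at least two neighbours in a clique K
-- misses at most two vertices of K.
--
-- A connected set C attached to a clique Q contains, by chordality, a vertex complete to Q (after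
-- discarding the vertices of Q without neighbours in C); moving it from C to Q and splitting into
-- components decomposes the graph with at most |Q| bits per set, as long as |Q| stays below 8.
-- Once |Q| = 8, extend Q to a maximal clique K of Q ∪ C. Components of vertices with at most one
-- neighbour in K hang on a single vertex and can be split off. Every other vertex outside K misses
-- one or two vertices of K, and then there is a set A ⊇ Q with |A| ≤ 12 such that each vertex
-- outside K ∪ A misses at most one vertex of K ∖ A, the vertices which miss one are isolated
-- outside K ∪ A, and the remaining ones induce a forest. So the forest may be built first, then
-- the vertices of K ∖ A one by one, each followed by the vertices missing it, and finally
-- the rest of A.

open import Defs renaming (sym to adj-sym; irrefl to adj-irrefl)
open import Data.Bool using (Bool; _∧_; _∨_; false; true)
open import Data.Bool.Properties using (∨-identityʳ; ∨-zeroʳ) renaming (_≟_ to _≟ᵇ_)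
open import Data.Empty using (⊥-elim) renaming (⊥ to Absurd)
import Data.Fin as Fin
open import Data.Fin using (Fin; combine; splitAt; suc; toℕ; zero)
open import Data.Fin.Properties
  using (<-cmp; all?; any?; combine-injective; injective⇒≤; splitAt-↑ʳ; splitAt-↑ˡ; splitAt⁻¹-↑ʳ;
         splitAt⁻¹-↑ˡ)
import Data.Fin.Subset as Subset
open import Data.Fin.Subset using (Subset; _∈_; _∉_; _⊆_; inside; outside; ∣_∣; ⊤; ⊥)
open import Data.Fin.Subset.Properties
  using (_∈?_; nonempty?; p⊂q⇒∣p∣<∣q∣; p⊆q⇒∣p∣≤∣q∣; p─q⊆p; x∈p∧x∉q⇒x∈p─q; x∈p∪q⁺; x∈p∪q⁻; x∈⁅x⁆;
         x∈⁅y⁆⇒x≡y; ∈⊤; ∉⊥; ∣⁅x⁆∣≡1; ∣⊥∣≡0)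
open import Data.List
  using (List; []; _++_; _∷_; allFin; cartesianProduct; filter; length; lookup; map)
open import Data.List.Membership.Propositional using () renaming (_∈_ to _∈ˡ_)
open import Data.List.Membership.Propositional.Properties
  using (∈-allFin; ∈-cartesianProduct⁺; ∈-filter⁺; ∈-filter⁻; ∈-lookup; ∈-map⁺)
open import Data.List.Properties using (length-++; length-map)
import Data.List.Relation.Unary.All as All
open import Data.List.Relation.Unary.All using (All; []; _∷_)
open import Data.List.Relation.Unary.All.Properties using (++⁻ʳ; ++⁻ˡ; map⁻; ¬Any⇒All¬)
import Data.List.Relation.Unary.Any as Any
open import Data.List.Relation.Unary.Any using (Any; here; there)
open import Data.Nat using (_*_; _+_; _<_; _^_; _≡ᵇ_; _≤?_; _≤_; suc; s≤s; zero; z≤n; ℕ)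
open import Data.Nat.Properties
  using (+-cancelˡ-≤; +-comm; +-identityʳ; +-mono-≤; +-monoʳ-≤; +-monoˡ-≤; +-suc; <-≤-trans; <⇒≱;
         m≤m+n; m≤n⇒m<n∨m≡n; m≤n⇒m≤1+n; n<1+n; n≤1+n; n≮0; ≤-antisym; ≤-refl; ≤-reflexive;
         ≤-trans; ≰⇒>)
open import Data.Product using (_,_; _×_; proj₁; proj₂; Σ; ∃-syntax)
open import Data.Sum using ([_,_]; _⊎_; inj₁; inj₂)
import Data.Vec as Vec
open import Data.Vec using (Vec; []; _∷_; here; tabulate; there)
open import Data.Vec.Properties using ([]=⇒lookup; lookup⇒[]=; lookup∘tabulate)
open import Function using (_∘_; id)
open import Function.Definitions using (Injective)
open import Relation.Binary.Definitions using (tri<; tri>; tri≈)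
open import Relation.Binary.PropositionalEquality using (_≡_; _≢_; cong; refl; subst; sym; trans)
open import Relation.Nullary using (Dec; contradiction; does; no; yes; ¬_)
open import Relation.Nullary.Decidable
  using (_×-dec_; _→-dec_; _⊎-dec_; dec-true; decidable-stable; from-yes; ¬?)

-- Finite vertex sets: membership and cardinality.

infixr 6 _∪_
infixl 5 _─_

-- Opaque, so that the subsets in a membership x ∈ p ∪ q can be inferred by unification.
opaque
  _∪_ _─_ : ∀ {n} → Subset n → Subset n → Subset n
  _∪_ = Subset._∪_
  _─_ = Subset._─_

  ⁅_⁆ : ∀ {n} → Fin n → Subset n
  ⁅_⁆ = Subset.⁅_⁆

  ⟨_⟩ : ∀ {n} {P : Fin n → Set} → (∀ x → Dec (P x)) → Subset n
  ⟨ P? ⟩ = tabulate (does ∘ P?)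

  ∪ˡ : ∀ {n} {p q : Subset n} → p ⊆ p ∪ q
  ∪ˡ = x∈p∪q⁺ ∘ inj₁

  ∪ʳ : ∀ {n} {p q : Subset n} → q ⊆ p ∪ q
  ∪ʳ = x∈p∪q⁺ ∘ inj₂

  ∪⁻ : ∀ {n} {p q : Subset n} {x} → x ∈ p ∪ q → x ∈ p ⊎ x ∈ q
  ∪⁻ = x∈p∪q⁻ _ _

  ─⁺ : ∀ {n} {p q : Subset n} {x} → x ∈ p → x ∉ q → x ∈ p ─ q
  ─⁺ = x∈p∧x∉q⇒x∈p─q

  ─⊆ : ∀ {n} {p q : Subset n} → p ─ q ⊆ p
  ─⊆ {p = p} {q} = p─q⊆p p q

  ─∉ : ∀ {n} {p q : Subset n} {x} → x ∈ p ─ q → x ∉ q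
  ─∉ {p = _ ∷ _} {outside ∷ _} here ()
  ─∉ {p = _ ∷ p} {_ ∷ q} (there i) (there j) = ─∉ {p = p} {q} i j

  ⁅⁆⁺ : ∀ {n} {x : Fin n} → x ∈ ⁅ x ⁆
  ⁅⁆⁺ = x∈⁅x⁆ _

  ⁅⁆⁻ : ∀ {n} {x y : Fin n} → x ∈ ⁅ y ⁆ → x ≡ y
  ⁅⁆⁻ = x∈⁅y⁆⇒x≡y _

  ⟨⟩⁺ : ∀ {n} {P : Fin n → Set} {P? : ∀ x → Dec (P x)} {x} → P x → x ∈ ⟨ P? ⟩
  ⟨⟩⁺ {P? = P?} {x} px = lookup⇒[]= x _ (trans (lookup∘tabulate (does ∘ P?) x) (dec-true (P? x) px))

  ⟨⟩⁻ : ∀ {n} {P : Fin n → Set} {P? : ∀ x → Dec (P x)} {x} → x ∈ ⟨ P? ⟩ → P x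
  ⟨⟩⁻ {P? = P?} {x} i with P? x | trans (sym (lookup∘tabulate (does ∘ P?) x)) ([]=⇒lookup i)
  ... | yes px | _ = px
  ... | no _   | ()

  ∣⁅⁆∣ : ∀ {n} (x : Fin n) → ∣ ⁅ x ⁆ ∣ ≡ 1
  ∣⁅⁆∣ = ∣⁅x⁆∣≡1

  ∣∪∣ : ∀ {n} (p q : Subset n) → ∣ p ∪ q ∣ ≤ ∣ p ∣ + ∣ q ∣
  ∣∪∣ [] [] = z≤n
  ∣∪∣ (outside ∷ p) (outside ∷ q) = ∣∪∣ p q
  ∣∪∣ (inside ∷ p) (outside ∷ q) = s≤s (∣∪∣ p q)
  ∣∪∣ (outside ∷ p) (inside ∷ q) = ≤-trans (s≤s (∣∪∣ p q)) (≤-reflexive (sym (+-suc ∣ p ∣ ∣ q ∣)))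
  ∣∪∣ (inside ∷ p) (inside ∷ q) = s≤s (≤-trans (∣∪∣ p q) (+-monoʳ-≤ ∣ p ∣ (m≤n⇒m≤1+n ≤-refl)))

module _ {n : ℕ} where

  ∣∣-mono : {p q : Subset n} → p ⊆ q → ∣ p ∣ ≤ ∣ q ∣
  ∣∣-mono = p⊆q⇒∣p∣≤∣q∣

  ∣∣-mono-< : {p q : Subset n} → p ⊆ q → ∀ {x} → x ∈ q → x ∉ p → ∣ p ∣ < ∣ q ∣
  ∣∣-mono-< p⊆q x∈q x∉p = p⊂q⇒∣p∣<∣q∣ (p⊆q , _ , x∈q , x∉p)

  ∣∪⁅⁆∣ : (p : Subset n) (x : Fin n) → ∣ p ∪ ⁅ x ⁆ ∣ ≤ suc ∣ p ∣
  ∣∪⁅⁆∣ p x = ≤-trans (∣∪∣ p ⁅ x ⁆) (≤-reflexive (trans (cong (∣ p ∣ +_) (∣⁅⁆∣ x)) (+-comm ∣ p ∣ 1)))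

  ∣∣≤∣─∣+ : (p q : Subset n) → ∣ p ∣ ≤ ∣ q ∣ + ∣ p ─ q ∣
  ∣∣≤∣─∣+ p q = ≤-trans (∣∣-mono split) (∣∪∣ q (p ─ q))
    where
    split : p ⊆ q ∪ (p ─ q)
    split {x} x∈p with x ∈? q
    ... | yes x∈q = ∪ˡ x∈q
    ... | no  x∉q = ∪ʳ (─⁺ x∈p x∉q)

  Disjoint : Subset n → Subset n → Set
  Disjoint p q = ∀ {x} → x ∈ p → x ∉ q

  pick : ∀ {k} (p : Subset n) → suc k ≤ ∣ p ∣ → ∃[ x ] (x ∈ p × k ≤ ∣ p ─ ⁅ x ⁆ ∣)
  pick {k} p k<p with nonempty? p
  ... | yes (x , x∈p) = x , x∈p , aux (≤-trans k<p (∣∣≤∣─∣+ p ⁅ x ⁆))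
    where
    aux : suc k ≤ ∣ ⁅ x ⁆ ∣ + ∣ p ─ ⁅ x ⁆ ∣ → k ≤ ∣ p ─ ⁅ x ⁆ ∣
    aux le rewrite ∣⁅⁆∣ x with le
    ... | s≤s le′ = le′
  ... | no ¬ne = ⊥-elim (n≮0 (≤-trans k<p (≤-trans (∣∣-mono {p} {⊥} (λ i → ⊥-elim (¬ne (_ , i))))
      (≤-reflexive (∣⊥∣≡0 n)))))

  pick₂ : (p : Subset n) → 2 ≤ ∣ p ∣ → ∃[ x ] ∃[ y ] (x ∈ p × y ∈ p × x ≢ y)
  pick₂ p 2≤p with pick p 2≤p
  ... | x , x∈p , 1≤ with pick (p ─ ⁅ x ⁆) 1≤
  ...   | y , y∈ , _ = x , y , x∈p , ─⊆ y∈ , λ { refl → ─∉ y∈ ⁅⁆⁺ }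

  pick₃ : (p : Subset n) → 3 ≤ ∣ p ∣ →
          ∃[ x ] ∃[ y ] ∃[ z ] (x ∈ p × y ∈ p × z ∈ p × x ≢ y × x ≢ z × y ≢ z)
  pick₃ p 3≤p with pick p 3≤p
  ... | x , x∈p , 2≤ with pick₂ (p ─ ⁅ x ⁆) 2≤
  ...   | y , z , y∈ , z∈ , y≢z =
    x , y , z , x∈p , ─⊆ y∈ , ─⊆ z∈ , (λ { refl → ─∉ y∈ ⁅⁆⁺ }) , (λ { refl → ─∉ z∈ ⁅⁆⁺ }) , y≢z

  1≤∣∣ : {p : Subset n} {x : Fin n} → x ∈ p → 1 ≤ ∣ p ∣
  1≤∣∣ {p} {x} x∈p = ≤-trans (≤-reflexive (sym (∣⁅⁆∣ x)))
      (∣∣-mono (λ i → subst (_∈ p) (sym (⁅⁆⁻ i)) x∈p))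

  2≤∣∣ : {p : Subset n} {x y : Fin n} → x ∈ p → y ∈ p → x ≢ y → 2 ≤ ∣ p ∣
  2≤∣∣ {p} {x} x∈p y∈p x≢y = ≤-trans (s≤s (1≤∣∣ {⁅ x ⁆} ⁅⁆⁺))
    (∣∣-mono-< (λ i → subst (_∈ p) (sym (⁅⁆⁻ i)) x∈p) y∈p (λ i → x≢y (sym (⁅⁆⁻ i))))

  3≤∣∣ : {p : Subset n} {x y z : Fin n} → x ∈ p → y ∈ p → z ∈ p → x ≢ y → x ≢ z → y ≢ z → 3 ≤ ∣ p ∣
  3≤∣∣ {p} {x} {y} x∈p y∈p z∈p x≢y x≢z y≢z = ≤-trans (s≤s (2≤∣∣ (∪ˡ ⁅⁆⁺) (∪ʳ ⁅⁆⁺) x≢y))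
    (∣∣-mono-< {p = ⁅ x ⁆ ∪ ⁅ y ⁆} sub z∈p λ i → [ (λ j → x≢z (sym (⁅⁆⁻ j))) ,
        (λ j → y≢z (sym (⁅⁆⁻ j))) ] (∪⁻ i))
    where
    sub : ⁅ x ⁆ ∪ ⁅ y ⁆ ⊆ p
    sub i with ∪⁻ i
    ... | inj₁ j = subst (_∈ p) (sym (⁅⁆⁻ j)) x∈p
    ... | inj₂ j = subst (_∈ p) (sym (⁅⁆⁻ j)) y∈p

elements : ∀ {n} (p : Subset n) → ∃[ xs ] (length xs ≤ ∣ p ∣ × (∀ {x} → x ∈ p → x ∈ˡ xs))
elements [] = [] , z≤n , λ ()
elements (outside ∷ p) with elements p
... | xs , len , all = map suc xs , ≤-trans (≤-reflexive (length-map suc xs)) len ,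
                       λ { (there i) → ∈-map⁺ suc (all i) }
elements (inside ∷ p) with elements p
... | xs , len , all = zero ∷ map suc xs , s≤s (≤-trans (≤-reflexive (length-map suc xs)) len) ,
                       λ { here → here refl ; (there i) → there (∈-map⁺ suc (all i)) }

-- Boolean equations; relabelling and joining clique-width expressions.

true≢false : {b : Bool} → b ≡ true → b ≡ false → ∀ {ℓ} {A : Set ℓ} → A
true≢false refl ()

==-true : ∀ {k} {a b : Fin k} → a ≡ b → (a == b) ≡ true
==-true {a = a} {b} eq with a Fin.≟ b
... | yes _ = refl
... | no ne = contradiction eq ne

==-false : ∀ {k} {a b : Fin k} → a ≢ b → (a == b) ≡ false
==-false {a = a} {b} ne with a Fin.≟ b
... | yes eq = contradiction eq ne
... | no _ = refl

==-sound : ∀ {k} (a b : Fin k) → (a == b) ≡ true → a ≡ b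
==-sound a b eq with a Fin.≟ b
... | yes e = e

∧-sound : ∀ {a b} → (a ∧ b) ≡ true → a ≡ true × b ≡ true
∧-sound {true} {true} _ = refl , refl

∨-sound : ∀ {a b} → (a ∨ b) ≡ true → a ≡ true ⊎ b ≡ true
∨-sound {true} _ = inj₁ refl
∨-sound {false} eq = inj₂ eq

∨ˡ : ∀ {a b} → a ≡ true → (a ∨ b) ≡ true
∨ˡ refl = refl

∨ʳ : ∀ {a b} → b ≡ true → (a ∨ b) ≡ true
∨ʳ {a} refl = ∨-zeroʳ a

∧⁺ : ∀ {a b} → a ≡ true → b ≡ true → (a ∧ b) ≡ true
∧⁺ refl refl = refl

true-ext : ∀ {a b} → (a ≡ true → b ≡ true) → (b ≡ true → a ≡ true) → a ≡ b
true-ext {true} {b} f g = sym (f refl)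
true-ext {false} {true} f g = g refl
true-ext {false} {false} f g = refl

-- Labels used while an expression is built: three copies of Fin L. The finished parts carry
-- zone 0; the two arguments of a union are moved to zones 1 and 2 and joined across.
module Zones (L : ℕ) where

  Lab : Set
  Lab = Fin (3 * L)

  opaque
    lab : Fin 3 → Fin L → Lab
    lab z l = combine z l

    lab-inj₁ : ∀ {z z′ l l′} → lab z l ≡ lab z′ l′ → z ≡ z′
    lab-inj₁ {z} {z′} {l} {l′} = proj₁ ∘ combine-injective z l z′ l′

    lab-inj₂ : ∀ {z z′ l l′} → lab z l ≡ lab z′ l′ → l ≡ l′
    lab-inj₂ {z} {z′} {l} {l′} = proj₂ ∘ combine-injective z l z′ l′

  Expr : ℕ → Set
  Expr = CWExpr (3 * L)

  move : Fin 3 → Fin 3 → (Fin L → Fin L) → List (Fin L) → ∀ {s} → Expr s → Expr s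
  move z z′ g []       e = e
  move z z′ g (l ∷ ls) e = move z z′ g ls (relabel (lab z l) (lab z′ (g l)) e)

  move-edge : ∀ z z′ g ls {s} (e : Expr s) a b → edge (move z z′ g ls e) a b ≡ edge e a b
  move-edge z z′ g []       e a b = refl
  move-edge z z′ g (l ∷ ls) e a b = move-edge z z′ g ls (relabel _ _ e) a b

  relabel-hit : ∀ {i j s} (e : Expr s) a → label e a ≡ i → label (relabel i j e) a ≡ j
  relabel-hit e a eq rewrite ==-true eq = refl

  relabel-miss : ∀ {i j s} (e : Expr s) a → label e a ≢ i → label (relabel i j e) a ≡ label e a
  relabel-miss e a ne rewrite ==-false ne = refl

  move-miss : ∀ z z′ g ls {s} (e : Expr s) a {y l} → z ≢ y → label e a ≡ lab y l →
              label (move z z′ g ls e) a ≡ lab y l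
  move-miss z z′ g []        e a z≢y eq = eq
  move-miss z z′ g (l′ ∷ ls) e a z≢y eq = move-miss z z′ g ls _ a z≢y
    (trans (relabel-miss e a λ eq′ → z≢y (lab-inj₁ (trans (sym eq′) eq))) eq)

  -- Because the source and target zones differ, a label once moved is never caught by a later
  -- relabelling. The successive relabellings therefore act like one simultaneous map.
  move-hit : ∀ z z′ g ls {s} (e : Expr s) a {l} → z ≢ z′ → l ∈ˡ ls → label e a ≡ lab z l →
             label (move z z′ g ls e) a ≡ lab z′ (g l)
  move-hit z z′ g (l′ ∷ ls) e a {l} z≢z′ l∈ eq with l Fin.≟ l′ | l∈
  ... | yes refl | _ = move-miss z z′ g ls _ a z≢z′ (relabel-hit e a eq)
  ... | no  l≢l′ | here l≡l′ = contradiction l≡l′ l≢l′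
  ... | no  l≢l′ | there l∈ls = move-hit z z′ g ls _ a z≢z′ l∈ls
    (trans (relabel-miss e a λ eq′ → l≢l′ (lab-inj₂ (trans (sym eq) eq′))) eq)

  moveAll : Fin 3 → Fin 3 → (Fin L → Fin L) → ∀ {s} → Expr s → Expr s
  moveAll z z′ g = move z z′ g (allFin L)

  1≢2 : ∀ {l r} → lab (suc zero) l ≢ lab (suc (suc zero)) r
  1≢2 eq with lab-inj₁ eq
  ... | ()

  joins : List (Fin L × Fin L) → ∀ {s} → Expr s → Expr s
  joins [] e = e
  joins ((l , r) ∷ ps) e = joins ps (join (lab (suc zero) l) (lab (suc (suc zero)) r) 1≢2 e)

  joins-label : ∀ ps {s} (e : Expr s) a → label (joins ps e) a ≡ label e a
  joins-label [] e a = refl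
  joins-label ((l , r) ∷ ps) e a = joins-label ps _ a

  Joined : List (Fin L × Fin L) → Lab → Lab → Set
  Joined ps x y = ∃[ l ] ∃[ r ] ((l , r) ∈ˡ ps ×
    ((x ≡ lab (suc zero) l × y ≡ lab (suc (suc zero)) r) ⊎
        (x ≡ lab (suc (suc zero)) r × y ≡ lab (suc zero) l)))

  joins-edge⁻ : ∀ ps {s} (e : Expr s) a b → edge (joins ps e) a b ≡ true →
                edge e a b ≡ true ⊎ Joined ps (label e a) (label e b)
  joins-edge⁻ [] e a b eq = inj₁ eq
  joins-edge⁻ ((l , r) ∷ ps) e a b eq with joins-edge⁻ ps _ a b eq
  ... | inj₂ (l′ , r′ , i , m) = inj₂ (l′ , r′ , there i , m)
  ... | inj₁ eq′ with ∨-sound eq′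
  ...   | inj₁ eq″ = inj₁ eq″
  ...   | inj₂ eq″ with ∨-sound eq″
  ...     | inj₁ e₃ = let p , q = ∧-sound e₃ in inj₂ (l , r , here refl ,
      inj₁ (==-sound _ _ p , ==-sound _ _ q))
  ...     | inj₂ e₃ = let p , q = ∧-sound e₃ in inj₂ (l , r , here refl ,
      inj₂ (==-sound _ _ p , ==-sound _ _ q))

  join-old : ∀ i j i≢j {s} (e : Expr s) a b → edge e a b ≡ true → edge (join i j i≢j e) a b ≡ true
  join-old i j _ e a b eq = ∨ˡ eq

  join-new : ∀ i j i≢j {s} (e : Expr s) a b →
             (label e a ≡ i × label e b ≡ j) ⊎ (label e a ≡ j × label e b ≡ i) →
                 edge (join i j i≢j e) a b ≡ true
  join-new i j _ e a b (inj₁ (p , q)) = ∨ʳ {edge e a b} (∨ˡ (∧⁺ (==-true p) (==-true q)))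
  join-new i j _ e a b (inj₂ (p , q)) =
    ∨ʳ {edge e a b} (∨ʳ {(label e a == i) ∧ (label e b == j)} (∧⁺ (==-true p) (==-true q)))

  joins-edge⁺ : ∀ ps {s} (e : Expr s) a b → edge e a b ≡ true ⊎ Joined ps (label e a) (label e b) →
                edge (joins ps e) a b ≡ true
  joins-edge⁺ [] e a b (inj₁ eq) = eq
  joins-edge⁺ (_ ∷ ps) e a b (inj₁ eq) = joins-edge⁺ ps _ a b (inj₁ (join-old _ _ 1≢2 e a b eq))
  joins-edge⁺ (_ ∷ ps) e a b (inj₂ (l , r , there i , m)) = joins-edge⁺ ps _ a b (inj₂ (l , r , i , m))
  joins-edge⁺ (_ ∷ ps) e a b (inj₂ (l , r , here refl , m)) =
      joins-edge⁺ ps _ a b (inj₁ (join-new _ _ 1≢2 e a b m))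

-- From trees of vertex sets to clique-width expressions.

module Decomposition (G : Graph) where

  V : Set
  V = Fin (n G)

  infix 4 _~_ _~?_

  _~_ : V → V → Set
  x ~ y = adj G x y ≡ true

  _~?_ : ∀ x y → Dec (x ~ y)
  x ~? y = adj G x y ≟ᵇ true

  ~-sym : ∀ {x y} → x ~ y → y ~ x
  ~-sym {x} {y} = trans (adj-sym G y x)

  ~-irrefl : ∀ {x} → ¬ x ~ x
  ~-irrefl {x} p = true≢false p (adj-irrefl G x)

  ~⇒≢ : ∀ {x y} → x ~ y → x ≢ y
  ~⇒≢ p refl = ~-irrefl p

  Agree : List (V → Bool) → V → V → Set
  Agree bs x y = All (λ b → b x ≡ b y) bs

  -- At most 2 ^ m neighbourhoods in U ∖ X are left by the vertices of X, up to the vertices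
  -- outside `live`, which have no neighbour there at all.
  record Typed (m : ℕ) (U X : Subset (n G)) : Set where
    field
      bits : List (V → Bool)
      few  : length bits ≤ m
      live : Subset (n G)
      dead : ∀ {x y} → x ∈ X → x ∉ live → y ∈ U → y ∉ X → ¬ x ~ y
      same : ∀ {x x′ y} → x ∈ X → x′ ∈ X → x ∈ live → x′ ∈ live → Agree bits x x′ →
             y ∈ U → y ∉ X → x ~ y → x′ ~ y

  -- Neighbours outside the ambient set U are disregarded, so a part of the graph can be decomposed
  -- relative to a small surrounding and transported later. Only nodes carry a `Typed`, since a
  -- single vertex leaves a single neighbourhood.
  data Decomp (m : ℕ) (U : Subset (n G)) : Subset (n G) → Set where
    empty : ∀ {Z} → (∀ {x} → x ∉ Z) → Decomp m U Z
    leaf  : ∀ {Z} z → z ∈ Z → (∀ {x} → x ∈ Z → x ≡ z) → Decomp m U Z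
    node  : ∀ {X Y Z} → Decomp m U X → Decomp m U Y → Disjoint X Y → X ⊆ Z → Y ⊆ Z →
            (∀ {x} → x ∈ Z → x ∈ X ⊎ x ∈ Y) → Typed m U Z → Decomp m U Z

  encode : ∀ {m} (bs : List (V → Bool)) → length bs ≤ m →
           Σ (V → Fin (2 ^ m)) λ c → ∀ {x y} → c x ≡ c y → Agree bs x y
  encode {zero} [] z≤n = (λ _ → zero) , λ _ → []
  -- A list shorter than the bound is padded with constant digits.
  encode {suc m} [] z≤n = let c , p = encode {m} [] z≤n in (λ x → combine {2} zero (c x)) , λ _ → []
  encode {suc m} (b ∷ bs) (s≤s len) = let c , p = encode bs len in
    (λ x → combine {2} (side (b x)) (c x)) ,
    λ {x} {y} eq →
      let q , r = combine-injective (side (b x)) (c x) (side (b y)) (c y) eq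
      in side-inj q ∷ p r
    where
    side : Bool → Fin 2
    side true = zero
    side false = suc zero
    side-inj : ∀ {a b} → side a ≡ side b → a ≡ b
    side-inj {true} {true} _ = refl
    side-inj {false} {false} _ = refl

  module Build (m : ℕ) where

    -- The bit beyond m records membership in `live`.
    L : ℕ
    L = 2 ^ suc m

    open Zones L

    Coded : Subset (n G) → Set
    Coded X = Σ (V → Fin L) λ c → ∀ {x x′ y} → x ∈ X → x′ ∈ X → c x ≡ c x′ → y ∉ X → x ~ y → x′ ~ y

    typed⇒coded : ∀ {X} → Typed m ⊤ X → Coded X
    typed⇒coded {X} T = proj₁ enc , λ {x} {x′} x∈ x′∈ eq → go x∈ x′∈ (proj₂ enc {x} {x′} eq)
      where
      open Typed T
      enc = encode ((λ x → does (x ∈? live)) ∷ bits) (s≤s few)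
      go : ∀ {x x′ y} → x ∈ X → x′ ∈ X → Agree ((λ x → does (x ∈? live)) ∷ bits) x x′ → y ∉ X →
          x ~ y → x′ ~ y
      go {x} {x′} x∈ x′∈ (b ∷ bs) y∉ x~y with x ∈? live | x′ ∈? live
      ... | yes l | yes l′ = same x∈ x′∈ l l′ bs ∈⊤ y∉ x~y
      ... | no ¬l | no _ = contradiction x~y (dead x∈ ¬l ∈⊤ y∉)
      go _ _ (() ∷ _) _ _ | yes _ | no _
      go _ _ (() ∷ _) _ _ | no _ | yes _

    -- The invariant of the construction: all labels are in zone `zero`, and equal labels mean equal
    -- neighbourhoods outside X. The latter makes adjacency between label classes of disjoint parts
    -- all or nothing.
    record Built (X : Subset (n G)) : Set where
      field
        {size} : ℕ
        expr   : Expr size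
        pt     : Fin size → V
        pt-inj : ∀ {a b} → pt a ≡ pt b → a ≡ b
        pt∈    : ∀ a → pt a ∈ X
        cover  : ∀ {x} → x ∈ X → ∃[ a ] pt a ≡ x
        type   : Fin size → Fin L
        labels : ∀ a → label expr a ≡ lab zero (type a)
        edges  : ∀ a b → edge expr a b ≡ adj G (pt a) (pt b)
        same   : ∀ {a b y} → type a ≡ type b → y ∉ X → pt a ~ y → pt b ~ y

    single : ∀ {Z} z → z ∈ Z → (∀ {x} → x ∈ Z → x ≡ z) → Built Z
    single z z∈ only = record
      { expr = vtx (lab zero l₀) ; pt = λ _ → z ; pt-inj = λ { {zero} {zero} _ → refl } ; pt∈ = λ _ → z∈
      ; cover = λ x∈ → zero , sym (only x∈) ; type = λ _ → l₀ ; labels = λ _ → refl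
      ; edges = λ _ _ → sym (adj-irrefl G z) ; same = λ _ _ p → p }
      where
      -- Any label serves; the code of the empty list of bits exhibits one.
      l₀ : Fin L
      l₀ = proj₁ (encode {suc m} [] z≤n) z

    resize : ∀ {X Z} → X ⊆ Z → Z ⊆ X → Built X → Built Z
    resize X⊆Z Z⊆X B = record
      { expr = expr ; pt = pt ; pt-inj = pt-inj ; pt∈ = X⊆Z ∘ pt∈ ; cover = cover ∘ Z⊆X ; type = type
      ; labels = labels ; edges = edges ; same = λ eq y∉ → same eq (y∉ ∘ X⊆Z) }
      where open Built B

    -- Moving the two parts to zones one and two separates their labels. After the union, every pair
    -- of classes with an edge between them is joined completely, and both zones return to zone
    -- `zero` under the labels prescribed by the code of Z.
    merge : ∀ {X Y Z} → Built X → Built Y → Disjoint X Y → X ⊆ Z → Y ⊆ Z →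
            (∀ {x} → x ∈ Z → x ∈ X ⊎ x ∈ Y) → Coded Z → Built Z
    merge {X} {Y} {Z} B₁ B₂ disj X⊆Z Y⊆Z split (code , code-same) = record
      { expr = expr ; pt = pt ; pt-inj = λ {a} {b} → pt-inj a b ; pt∈ = pt∈ ; cover = cover ; type = type
      ; labels = labels ; edges = λ a b → true-ext (edges⁻ a b) (edges⁺ a b)
      ; same = λ {a} {b} → same a b }
      where
      module B₁ = Built B₁
      module B₂ = Built B₂
      s₁ = B₁.size
      s₂ = B₂.size

      one two : Fin 3
      one = suc zero
      two = suc (suc zero)

      adjacent? : ∀ (p : Fin L × Fin L) →
        Dec (∃[ a ] ∃[ b ] (B₁.type a ≡ proj₁ p × B₂.type b ≡ proj₂ p × B₁.pt a ~ B₂.pt b))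
      adjacent? (l , r) = any? λ a → any? λ b →
        (B₁.type a Fin.≟ l) ×-dec (B₂.type b Fin.≟ r) ×-dec (B₁.pt a ~? B₂.pt b)

      ps : List (Fin L × Fin L)
      ps = filter adjacent? (cartesianProduct (allFin L) (allFin L))

      -- Members of one class may have different codes, so the class takes the code of a chosen
      -- representative. The default `l` concerns labels that do not occur.
      recode : ∀ {s} → (Fin s → Fin L) → (Fin s → V) → Fin L → Fin L
      recode ty p l with any? (λ a → ty a Fin.≟ l)
      ... | yes (a , _) = code (p a)
      ... | no _ = l

      recode-rep : ∀ {s} (ty : Fin s → Fin L) (p : Fin s → V) a →
                   ∃[ a′ ] (ty a′ ≡ ty a × recode ty p (ty a) ≡ code (p a′))
      recode-rep ty p a with any? (λ a′ → ty a′ Fin.≟ ty a)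
      ... | yes (a′ , eq) = a′ , eq , refl
      ... | no ¬ex = contradiction (a , refl) ¬ex

      g₁ = recode B₁.type B₁.pt
      g₂ = recode B₂.type B₂.pt

      e₁ : Expr s₁
      e₁ = moveAll zero one id B₁.expr
      e₂ : Expr s₂
      e₂ = moveAll zero two id B₂.expr
      e : Expr (s₁ + s₂)
      e = union e₁ e₂
      expr : Expr (s₁ + s₂)
      expr = moveAll two zero g₂ (moveAll one zero g₁ (joins ps e))

      pt : Fin (s₁ + s₂) → V
      pt v = [ B₁.pt , B₂.pt ] (splitAt s₁ v)

      type : Fin (s₁ + s₂) → Fin L
      type v = [ g₁ ∘ B₁.type , g₂ ∘ B₂.type ] (splitAt s₁ v)

      clash : ∀ {a b} {A : Set} → B₁.pt a ≡ B₂.pt b → A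
      clash {a} {b} eq = ⊥-elim (disj (subst (_∈ X) eq (B₁.pt∈ a)) (B₂.pt∈ b))

      pt-inj : ∀ a b → pt a ≡ pt b → a ≡ b
      pt-inj a b eq with splitAt s₁ a in p | splitAt s₁ b in q
      ... | inj₁ a′ | inj₁ b′ = trans (sym (splitAt⁻¹-↑ˡ p))
          (trans (cong (Fin._↑ˡ s₂) (B₁.pt-inj eq)) (splitAt⁻¹-↑ˡ q))
      ... | inj₂ a′ | inj₂ b′ = trans (sym (splitAt⁻¹-↑ʳ p))
          (trans (cong (s₁ Fin.↑ʳ_) (B₂.pt-inj eq)) (splitAt⁻¹-↑ʳ q))
      ... | inj₁ a′ | inj₂ b′ = clash eq
      ... | inj₂ a′ | inj₁ b′ = clash (sym eq)

      pt∈ : ∀ a → pt a ∈ Z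
      pt∈ a with splitAt s₁ a
      ... | inj₁ a′ = X⊆Z (B₁.pt∈ a′)
      ... | inj₂ a′ = Y⊆Z (B₂.pt∈ a′)

      cover : ∀ {x} → x ∈ Z → ∃[ a ] pt a ≡ x
      cover x∈ with split x∈
      ... | inj₁ x∈X = let a , eq = B₁.cover x∈X in
        a Fin.↑ˡ s₂ , trans (cong [ B₁.pt , B₂.pt ] (splitAt-↑ˡ s₁ a s₂)) eq
      ... | inj₂ x∈Y = let a , eq = B₂.cover x∈Y in
        s₁ Fin.↑ʳ a , trans (cong [ B₁.pt , B₂.pt ] (splitAt-↑ʳ s₁ s₂ a)) eq

      label₁ : ∀ a → label e₁ a ≡ lab one (B₁.type a)
      label₁ a = move-hit zero one id (allFin L) B₁.expr a (λ ()) (∈-allFin _) (B₁.labels a)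

      label₂ : ∀ a → label e₂ a ≡ lab two (B₂.type a)
      label₂ a = move-hit zero two id (allFin L) B₂.expr a (λ ()) (∈-allFin _) (B₂.labels a)

      label-e : ∀ v → label e v ≡ [ lab one ∘ B₁.type , lab two ∘ B₂.type ] (splitAt s₁ v)
      label-e v with splitAt s₁ v
      ... | inj₁ a = label₁ a
      ... | inj₂ a = label₂ a

      labels : ∀ v → label expr v ≡ lab zero (type v)
      labels v with splitAt s₁ v | trans (joins-label ps e v) (label-e v)
      ... | inj₁ a | eq = move-miss two zero g₂ (allFin L) _ v (λ ())
                            (move-hit one zero g₁ (allFin L) (joins ps e) v (λ ()) (∈-allFin _) eq)
      ... | inj₂ a | eq = move-hit two zero g₂ (allFin L) _ v (λ ()) (∈-allFin _)
                            (move-miss one zero g₁ (allFin L) (joins ps e) v (λ ()) eq)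

      expr-edge : ∀ a b → edge expr a b ≡ edge (joins ps e) a b
      expr-edge a b = trans (move-edge two zero g₂ (allFin L) _ a b)
          (move-edge one zero g₁ (allFin L) _ a b)

      e₁-edge : ∀ a b → edge e₁ a b ≡ adj G (B₁.pt a) (B₁.pt b)
      e₁-edge a b = trans (move-edge zero one id (allFin L) B₁.expr a b) (B₁.edges a b)

      e₂-edge : ∀ a b → edge e₂ a b ≡ adj G (B₂.pt a) (B₂.pt b)
      e₂-edge a b = trans (move-edge zero two id (allFin L) B₂.expr a b) (B₂.edges a b)

      out₁ : ∀ a → B₁.pt a ∉ Y
      out₁ a = disj (B₁.pt∈ a)

      out₂ : ∀ a → B₂.pt a ∉ X
      out₂ a i = disj i (B₂.pt∈ a)

      -- The pair of labels is listed because of some edge between the two classes; `same` on each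
      -- side carries this edge to a and b.
      joined⁻ : ∀ {a b l r} → (l , r) ∈ˡ ps → lab one (B₁.type a) ≡ lab one l →
                lab two (B₂.type b) ≡ lab two r → B₁.pt a ~ B₂.pt b
      joined⁻ {a} {b} lr∈ p q with proj₂ (∈-filter⁻ adjacent? {xs =
          cartesianProduct (allFin L) (allFin L)} lr∈)
      ... | a′ , b′ , ta , tb , adjacent =
        B₁.same (trans ta (sym (lab-inj₂ {one} {one} p))) (out₂ b)
            (~-sym (B₂.same (trans tb (sym (lab-inj₂ {two} {two} q))) (out₁ a′) (~-sym adjacent)))

      edges⁻ : ∀ a b → edge expr a b ≡ true → pt a ~ pt b
      edges⁻ a b eq with joins-edge⁻ ps e a b (trans (sym (expr-edge a b)) eq)
      edges⁻ a b eq | inj₁ eq′ with splitAt s₁ a | splitAt s₁ b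
      ... | inj₁ a′ | inj₁ b′ = trans (sym (e₁-edge a′ b′)) eq′
      ... | inj₂ a′ | inj₂ b′ = trans (sym (e₂-edge a′ b′)) eq′
      edges⁻ a b eq | inj₂ (l , r , lr∈ , jn) with splitAt s₁ a | splitAt s₁ b | jn
      ... | inj₁ a′ | inj₁ b′ | inj₁ (_ , q) = ⊥-elim (1≢2 (trans (sym (label₁ b′)) q))
      ... | inj₁ a′ | inj₁ b′ | inj₂ (p , _) = ⊥-elim (1≢2 (trans (sym (label₁ a′)) p))
      ... | inj₂ a′ | inj₂ b′ | inj₁ (p , _) = ⊥-elim (1≢2 (sym (trans (sym (label₂ a′)) p)))
      ... | inj₂ a′ | inj₂ b′ | inj₂ (_ , q) = ⊥-elim (1≢2 (sym (trans (sym (label₂ b′)) q)))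
      ... | inj₁ a′ | inj₂ b′ | inj₁ (p , q) = joined⁻ lr∈ (trans (sym (label₁ a′)) p)
          (trans (sym (label₂ b′)) q)
      ... | inj₁ a′ | inj₂ b′ | inj₂ (p , q) = ⊥-elim (1≢2 (trans (sym (label₁ a′)) p))
      ... | inj₂ a′ | inj₁ b′ | inj₁ (p , q) = ⊥-elim (1≢2 (sym (trans (sym (label₂ a′)) p)))
      ... | inj₂ a′ | inj₁ b′ | inj₂ (p , q) = ~-sym (joined⁻ lr∈ (trans (sym (label₁ b′)) q)
          (trans (sym (label₂ a′)) p))

      pair∈ : ∀ {a b} → B₁.pt a ~ B₂.pt b → (B₁.type a , B₂.type b) ∈ˡ ps
      pair∈ {a} {b} adjacent = ∈-filter⁺ adjacent? (∈-cartesianProduct⁺ (∈-allFin _) (∈-allFin _))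
          (a , b , refl , refl , adjacent)

      edges-e : ∀ a b → pt a ~ pt b → edge e a b ≡ true ⊎ Joined ps (label e a) (label e b)
      edges-e a b adjacent with splitAt s₁ a | splitAt s₁ b
      ... | inj₁ a′ | inj₁ b′ = inj₁ (trans (e₁-edge a′ b′) adjacent)
      ... | inj₂ a′ | inj₂ b′ = inj₁ (trans (e₂-edge a′ b′) adjacent)
      ... | inj₁ a′ | inj₂ b′ = inj₂ (_ , _ , pair∈ adjacent , inj₁ (label₁ a′ , label₂ b′))
      ... | inj₂ a′ | inj₁ b′ = inj₂ (_ , _ , pair∈ (~-sym adjacent) , inj₂ (label₂ a′ , label₁ b′))

      edges⁺ : ∀ a b → pt a ~ pt b → edge expr a b ≡ true
      edges⁺ a b adjacent = trans (expr-edge a b) (joins-edge⁺ ps e a b (edges-e a b adjacent))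

      -- A vertex and the representative of its old class have the same neighbours outside Z, so the
      -- invariant for Z only has to be checked on representatives, where the code decides.
      rep : ∀ v → ∃[ w ] (w ∈ Z × type v ≡ code w ×
                          (∀ {y} → y ∉ Z → pt v ~ y → w ~ y) × (∀ {y} → y ∉ Z → w ~ y → pt v ~ y))
      rep v with splitAt s₁ v
      ... | inj₁ a = let a′ , eq , c = recode-rep B₁.type B₁.pt a in
        B₁.pt a′ , X⊆Z (B₁.pt∈ a′) , c , (λ y∉ → B₁.same (sym eq) (y∉ ∘ X⊆Z)) ,
            (λ y∉ → B₁.same eq (y∉ ∘ X⊆Z))
      ... | inj₂ a = let a′ , eq , c = recode-rep B₂.type B₂.pt a in
        B₂.pt a′ , Y⊆Z (B₂.pt∈ a′) , c , (λ y∉ → B₂.same (sym eq) (y∉ ∘ Y⊆Z)) ,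
            (λ y∉ → B₂.same eq (y∉ ∘ Y⊆Z))

      same : ∀ a b {y} → type a ≡ type b → y ∉ Z → pt a ~ y → pt b ~ y
      same a b eq y∉ a~y = let wa , wa∈ , ca , fa , _ = rep a
                               wb , wb∈ , cb , _ , fb = rep b
                           in fb y∉ (code-same wa∈ wb∈ (trans (sym ca) (trans eq cb)) y∉ (fa y∉ a~y))

    -- Every expression has a vertex, so empty parts are reported separately and dropped at the node
    -- above.
    build : ∀ {X} → Decomp m ⊤ X → (∀ {x} → x ∉ X) ⊎ Built X
    build (empty ∉Z) = inj₁ ∉Z
    build (leaf z z∈ only) = inj₂ (single z z∈ only)
    build (node D₁ D₂ disj X⊆Z Y⊆Z split T) with build D₁ | build D₂
    ... | inj₂ B₁ | inj₂ B₂ = inj₂ (merge B₁ B₂ disj X⊆Z Y⊆Z split (typed⇒coded T))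
    ... | inj₁ ∉X | inj₁ ∉Y = inj₁ λ i → [ ∉X , ∉Y ] (split i)
    ... | inj₁ ∉X | inj₂ B₂ = inj₂ (resize Y⊆Z (λ i → [ (λ j → ⊥-elim (∉X j)) , id ] (split i)) B₂)
    ... | inj₂ B₁ | inj₁ ∉Y = inj₂ (resize X⊆Z (λ i → [ id , (λ j → ⊥-elim (∉Y j)) ] (split i)) B₁)

  decomp⇒cw : ∀ {m} → Decomp m ⊤ ⊤ → CWAtMost (3 * 2 ^ suc m) G
  decomp⇒cw {m} D with Build.build m D
  ... | inj₁ none = inj₁ (no-vertices (n G) λ x → none {x} ∈⊤)
    where
    no-vertices : ∀ k → ¬ Fin k → k ≡ 0
    no-vertices zero _ = refl
    no-vertices (suc k) ¬x = ⊥-elim (¬x zero)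
  ... | inj₂ B = inj₂ (resized size≡ expr pt pt-inj edges)
    where
    open Build.Built B
    size≡ : size ≡ n G
    size≡ = ≤-antisym (injective⇒≤ pt-inj) (injective⇒≤ {f = λ x → proj₁ (cover {x} ∈⊤)} λ {x} {y} eq →
      trans (sym (proj₂ (cover {x} ∈⊤))) (trans (cong pt eq) (proj₂ (cover {y} ∈⊤))))
    resized : ∀ {s k} → s ≡ n G → (e : CWExpr k s) (π : Fin s → V) → (∀ {a b} → π a ≡ π b → a ≡ b) →
              (∀ a b → edge e a b ≡ adj G (π a) (π b)) →
              Σ (CWExpr k (n G)) λ e → Σ (V → V) λ π → Injective _≡_ _≡_ π ×
                  (∀ u v → edge e u v ≡ adj G (π u) (π v))
    resized refl e π inj es = e , π , inj , es

-- Induced paths, walks, and consequences of chordality.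

module Paths (G : Graph) where
  open Decomposition G

  ≁⇒false : ∀ {x y} → ¬ x ~ y → adj G x y ≡ false
  ≁⇒false {x} {y} ¬p with adj G x y
  ... | true = ⊥-elim (¬p refl)
  ... | false = refl

  Apart : V → V → Set
  Apart x w = x ≢ w × ¬ x ~ w

  -- Induced paths whose last two vertices are e and y.
  data Path (e y : V) : List V → Set where
    tail₂ : e ~ y → Path e y (e ∷ y ∷ [])
    cons : ∀ {x z l} → x ~ z → All (Apart x) l → Path e y (z ∷ l) → Path e y (x ∷ z ∷ l)

  penultimate : ∀ {e y l} → Path e y l → e ~ y
  penultimate (tail₂ e~y) = e~y
  penultimate (cons _ _ P) = penultimate P

  last∈ : ∀ {e y x l} → Path e y (x ∷ l) → y ∈ˡ l
  last∈ (tail₂ _) = here refl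
  last∈ (cons _ _ P) = there (last∈ P)

  head≢last : ∀ {e y x l} → Path e y (x ∷ l) → x ≢ y
  head≢last (tail₂ e~y) = ~⇒≢ e~y
  head≢last (cons x~z ap P) = proj₁ (All.lookup ap (last∈ P))

  Meets : V → V → Set
  Meets w c = (w ~ c) ⊎ (w ≡ c)

  meets? : ∀ w c → Dec (Meets w c)
  meets? w c = (w ~? c) ⊎-dec (w Fin.≟ c)

  apart : ∀ {w l} → ¬ Any (Meets w) l → All (Apart w) l
  apart ¬any = All.map (λ ¬m → ¬m ∘ inj₂ , ¬m ∘ inj₁) (¬Any⇒All¬ _ ¬any)

  -- Cutting the path at the last vertex that w meets.
  extend : ∀ {P : V → Set} {e y l} w → P w → w ≢ y → P e → All P l → Path e y l → Any (Meets w) l →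
           ∃[ e′ ] ∃[ l′ ] (Path e′ y (w ∷ l′) × P e′ × All P (w ∷ l′))
  extend w Pw w≢y Pe (Pe′ ∷ Py ∷ []) (tail₂ e~y) meets with meets? w _
  ... | yes (inj₁ w~y) = _ , _ , tail₂ w~y , Pw , Pw ∷ Py ∷ []
  ... | yes (inj₂ w≡y) = contradiction w≡y w≢y
  extend w Pw w≢y Pe (Pe′ ∷ Py ∷ []) (tail₂ e~y) (here (inj₁ w~e)) | no ¬m =
    _ , _ , cons w~e ((¬m ∘ inj₂ , ¬m ∘ inj₁) ∷ []) (tail₂ e~y) , Pe , Pw ∷ Pe′ ∷ Py ∷ []
  extend w Pw w≢y Pe (Pe′ ∷ Py ∷ []) (tail₂ e~y) (here (inj₂ refl)) | no ¬m =
    _ , _ , tail₂ e~y , Pe , Pe′ ∷ Py ∷ []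
  extend w Pw w≢y Pe (Pe′ ∷ Py ∷ []) (tail₂ e~y) (there (here m)) | no ¬m = contradiction m ¬m
  extend {l = x ∷ z ∷ l} w Pw w≢y Pe (Px ∷ Pl) (cons x~z ap Q) meets with Any.any? (meets? w) (z ∷ l)
  ... | yes meets′ = extend w Pw w≢y Pe Pl Q meets′
  extend w Pw w≢y Pe (Px ∷ Pl) (cons x~z ap Q) (here (inj₁ w~x)) | no ¬any =
    _ , _ , cons w~x (apart ¬any) (cons x~z ap Q) , Pe , Pw ∷ Px ∷ Pl
  extend w Pw w≢y Pe (Px ∷ Pl) (cons x~z ap Q) (here (inj₂ refl)) | no ¬any =
    _ , _ , cons x~z ap Q , Pe , Px ∷ Pl
  extend w Pw w≢y Pe (Px ∷ Pl) (cons x~z ap Q) (there m) | no ¬any = contradiction m ¬any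

  head-adj : ∀ {x z l} → x ~ z → All (Apart x) l → ∀ j → adj G x (lookup (z ∷ l) j) ≡ (toℕ j ≡ᵇ 0)
  head-adj x~z ap zero = x~z
  head-adj x~z ap (suc j) = ≁⇒false (proj₂ (All.lookup ap (∈-lookup j)))

  path-adj : ∀ {e y l} → Path e y l → ∀ i j →
             adj G (lookup l i) (lookup l j) ≡ (suc (toℕ i) ≡ᵇ toℕ j) ∨ (suc (toℕ j) ≡ᵇ toℕ i)
  path-adj (tail₂ e~y) zero zero = adj-irrefl G _
  path-adj (tail₂ e~y) zero (suc zero) = e~y
  path-adj (tail₂ e~y) (suc zero) zero = ~-sym e~y
  path-adj (tail₂ e~y) (suc zero) (suc zero) = adj-irrefl G _
  path-adj (cons x~z ap P) zero zero = adj-irrefl G _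
  path-adj (cons x~z ap P) zero (suc zero) = x~z
  path-adj (cons x~z ap P) zero (suc (suc j)) = head-adj x~z ap (suc j)
  path-adj (cons x~z ap P) (suc zero) zero = ~-sym x~z
  path-adj (cons x~z ap P) (suc (suc i)) zero = trans (adj-sym G _ _) (head-adj x~z ap (suc i))
  path-adj (cons x~z ap P) (suc i) (suc j) = path-adj P i j

  path-inj : ∀ {e y l} → Path e y l → ∀ i j → lookup l i ≡ lookup l j → i ≡ j
  path-inj (tail₂ _) zero zero eq = refl
  path-inj (cons _ _ _) zero zero eq = refl
  path-inj (tail₂ e~y) zero (suc zero) eq = contradiction eq (~⇒≢ e~y)
  path-inj (tail₂ e~y) (suc zero) zero eq = contradiction (sym eq) (~⇒≢ e~y)
  path-inj (tail₂ e~y) (suc zero) (suc zero) eq = refl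
  path-inj (cons x~z ap P) zero (suc zero) eq = contradiction eq (~⇒≢ x~z)
  path-inj (cons x~z ap P) zero (suc (suc j)) eq = contradiction eq (proj₁ (All.lookup ap (∈-lookup j)))
  path-inj (cons x~z ap P) (suc zero) zero eq = contradiction (sym eq) (~⇒≢ x~z)
  path-inj (cons x~z ap P) (suc (suc i)) zero eq = contradiction (sym eq)
      (proj₁ (All.lookup ap (∈-lookup i)))
  path-inj (cons x~z ap P) (suc i) (suc j) eq = cong suc (path-inj P i j eq)

  tip-adj : ∀ {e y l p} → Path e y l → p ~ y → All (λ c → c ≢ y → ¬ p ~ c) l →
            ∀ j → adj G p (lookup l j) ≡ (suc (toℕ j) ≡ᵇ length l)
  tip-adj (tail₂ e~y) p~y (¬p~e ∷ _) zero = ≁⇒false (¬p~e (~⇒≢ e~y))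
  tip-adj (tail₂ e~y) p~y _ (suc zero) = p~y
  tip-adj Q@(cons _ _ _) p~y (¬p~x ∷ _) zero = ≁⇒false (¬p~x (head≢last Q))
  tip-adj (cons x~z ap P) p~y (_ ∷ ¬p) (suc j) = tip-adj P p~y ¬p j

  data Walk (E : Subset (n G)) : V → V → Set where
    stop : ∀ {x} → x ∈ E → Walk E x x
    step : ∀ {x y z} → x ∈ E → x ~ y → Walk E y z → Walk E x z

  start∈ : ∀ {E x y} → Walk E x y → x ∈ E
  start∈ (stop x∈) = x∈
  start∈ (step x∈ _ _) = x∈

  walk-mono : ∀ {E E′ x y} → E ⊆ E′ → Walk E x y → Walk E′ x y
  walk-mono sub (stop x∈) = stop (sub x∈)
  walk-mono sub (step x∈ p w) = step (sub x∈) p (walk-mono sub w)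

  _++ʷ_ : ∀ {E x y z} → Walk E x y → Walk E y z → Walk E x z
  stop _ ++ʷ w = w
  step x∈ p v ++ʷ w = step x∈ p (v ++ʷ w)

  reverse : ∀ {E x y} → Walk E x y → Walk E y x
  reverse (stop x∈) = stop x∈
  reverse (step x∈ p w) = reverse w ++ʷ step (start∈ w) (~-sym p) (stop x∈)

  Connected : Subset (n G) → Set
  Connected E = ∀ {x y} → x ∈ E → y ∈ E → Walk E x y

  -- The walk is read from its end: each earlier vertex is put in front of the induced path found so
  -- far, which is cut where necessary by `extend`.
  walk⇒path : ∀ {E x c y} → Walk E x c → c ~ y → y ∉ E →
              ∃[ e ] ∃[ l ] (Path e y (x ∷ l) × (e ∈ E) × All (λ v → v ∈ E ⊎ v ≡ y) (x ∷ l))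
  walk⇒path (stop x∈) c~y y∉ = _ , _ , tail₂ c~y , x∈ , inj₁ x∈ ∷ inj₂ refl ∷ []
  walk⇒path {E} {y = y} (step {x} x∈ x~z w) c~y y∉ with walk⇒path w c~y y∉
  ... | e , l , P , e∈ , all
    with extend {P = λ v → v ∈ E ⊎ v ≡ y} x (inj₁ x∈) (λ { refl → y∉ x∈ }) (inj₁ e∈) all P
        (here (inj₁ x~z))
  ...   | e′ , l′ , P′ , inj₁ e′∈ , all′ = e′ , l′ , P′ , e′∈ , all′
  ...   | e′ , l′ , P′ , inj₂ refl , all′ = contradiction (penultimate P′) ~-irrefl

  Touches : V → Subset (n G) → Set
  Touches x E = ∃[ c ] (c ∈ E × x ~ c)

  module _ (chordal : Chordal G) where

    -- A vertex adjacent to exactly the two ends of an induced path closes it to an induced cycle.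
    -- That the penultimate vertex e differs from the first vertex z excludes a path of one edge, so
    -- the cycle has length at least 4.
    no-cycle : ∀ {e y z l p} → Path e y (z ∷ l) → p ~ z → p ~ y → ¬ e ≡ z → All (p ≢_) (z ∷ l) →
               All (λ c → c ≢ y → ¬ p ~ c) l → Absurd
    no-cycle {e} {y} {z} {l} {p} P p~z p~y e≢z p∉ ¬p~ = chordal _ (s≤s (long P e≢z))
        (lookup c , (λ {i} {j} → inj i j) , adjs)
      where
      c = p ∷ z ∷ l
      long : ∀ {e y z l} → Path e y (z ∷ l) → ¬ e ≡ z → 3 ≤ length (z ∷ l)
      long (tail₂ _) e≢ = contradiction refl e≢
      long (cons _ _ (tail₂ _)) _ = s≤s (s≤s (s≤s z≤n))
      long (cons _ _ (cons _ _ _)) _ = s≤s (s≤s (s≤s z≤n))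
      inj : ∀ i j → lookup c i ≡ lookup c j → i ≡ j
      inj zero zero _ = refl
      inj zero (suc j) eq = contradiction eq (All.lookup p∉ (∈-lookup j))
      inj (suc i) zero eq = contradiction (sym eq) (All.lookup p∉ (∈-lookup i))
      inj (suc i) (suc j) eq = cong suc (path-inj P i j eq)
      p-adj : ∀ {z l} → Path e y (z ∷ l) → p ~ z → ¬ e ≡ z → All (λ c → c ≢ y → ¬ p ~ c) l → ∀ j →
              (0 ≡ᵇ toℕ j) ∨ (suc (toℕ j) ≡ᵇ length (z ∷ l)) ≡ adj G p (lookup (z ∷ l) j)
      p-adj (tail₂ _) p~z e≢z ¬p~ j = contradiction refl e≢z
      p-adj (cons _ _ P) p~z e≢z ¬p~ zero = sym p~z
      p-adj (cons _ _ P) p~z e≢z ¬p~ (suc j) = sym (tip-adj P p~y ¬p~ j)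
      adjs : ∀ i j → cycleAdj (length c) i j ≡ adj G (lookup c i) (lookup c j)
      adjs zero zero = sym (adj-irrefl G p)
      adjs zero (suc j) = trans (reorder (0 ≡ᵇ toℕ j) _) (p-adj P p~z e≢z ¬p~ j)
        where
        reorder : ∀ a b → a ∨ (false ∨ (b ∨ false)) ≡ a ∨ b
        reorder a b = cong (a ∨_) (∨-identityʳ b)
      adjs (suc i) zero = trans (p-adj P p~z e≢z ¬p~ i) (adj-sym G _ _)
      adjs (suc i) (suc j) = trans (cong ((suc (toℕ i) ≡ᵇ toℕ j) ∨_) (∨-identityʳ _))
          (sym (path-adj P i j))

    -- Among the neighbours of p on the path other than y, the one nearest to y closes an induced
    -- cycle with p, unless it is e.
    scan : ∀ {e y z l p} → Path e y (z ∷ l) → p ~ y → All (p ≢_) (z ∷ l) →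
           p ~ e ⊎ All (λ c → c ≢ y → ¬ p ~ c) (z ∷ l)
    scan {e} {p = p} (tail₂ e~y) p~y p∉ with p ~? e
    ... | yes p~e = inj₁ p~e
    ... | no ¬p~e = inj₂ ((λ _ → ¬p~e) ∷ (λ y≢y → ⊥-elim (y≢y refl)) ∷ [])
    scan {e} {z = x} {p = p} Q@(cons x~z ap P) p~y p∉@(_ ∷ p∉′) with scan P p~y p∉′ | p ~? x
    ... | inj₁ p~e | _ = inj₁ p~e
    ... | inj₂ none | no ¬p~x = inj₂ ((λ _ → ¬p~x) ∷ none)
    ... | inj₂ none | yes p~x with e Fin.≟ x
    ...   | yes refl = inj₁ p~x
    ...   | no e≢x = ⊥-elim (no-cycle Q p~x p~y e≢x p∉ none)

    fan-path : ∀ {e y x l p} → Path e y (x ∷ l) → p ~ x → p ~ y → All (p ≢_) (x ∷ l) → p ~ e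
    fan-path P p~x p~y p∉ with scan P p~y p∉
    ... | inj₁ p~e = p~e
    ... | inj₂ (¬p~x ∷ _) = contradiction p~x (¬p~x (head≢last P))

    C₄ : ∀ {a b c d} → a ~ b → b ~ c → c ~ d → d ~ a → a ≢ c → ¬ a ~ c → b ≢ d → ¬ b ~ d → Absurd
    C₄ a~b b~c c~d d~a a≢c ¬a~c b≢d ¬b~d =
      no-cycle (cons b~c ((b≢d , ¬b~d) ∷ []) (tail₂ c~d)) a~b (~-sym d~a) (~⇒≢ (~-sym b~c))
        (~⇒≢ a~b ∷ a≢c ∷ ~⇒≢ (~-sym d~a) ∷ []) ((λ _ → ¬a~c) ∷ (λ d≢d → ⊥-elim (d≢d refl)) ∷ [])

    -- Take an induced x–y path inside E ∪ {x, y}: by chordality a common neighbour of its ends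
    -- is adjacent to all of it, in particular to the vertex e next to y.
    fan : ∀ {E x y} → Connected E → x ≢ y → ¬ x ~ y → y ∉ E → x ∈ E ⊎ Touches x E → Touches y E →
          ∃[ e ] (e ∈ E × e ~ y × (∀ {p} → p ∉ E → p ~ x → p ~ y → p ~ e))
    fan {E} {x} {y} con x≢y ¬x~y y∉ (inj₁ x∈) (c , c∈ , y~c) with walk⇒path (con x∈ c∈) (~-sym y~c) y∉
    ... | e , l , P , e∈ , all = e , e∈ , penultimate P , λ {p} p∉ p~x p~y →
      fan-path P p~x p~y (All.map (λ { (inj₁ v∈) refl → p∉ v∈ ; (inj₂ v≡y) refl → ~⇒≢ p~y v≡y }) all)
    fan {E} {x} {y} con x≢y ¬x~y y∉ (inj₂ (b , b∈ , x~b)) (c , c∈ , y~c)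
      with walk⇒path (con b∈ c∈) (~-sym y~c) y∉
    ... | e₀ , l₀ , P₀ , e₀∈ , all₀
      with extend {P = λ v → v ∈ E ⊎ v ≡ y ⊎ v ≡ x} x (inj₂ (inj₂ refl)) x≢y (inj₁ e₀∈)
             (All.map (λ { (inj₁ i) → inj₁ i ; (inj₂ i) → inj₂ (inj₁ i) }) all₀) P₀ (here (inj₁ x~b))
    ...   | e , l , P , inj₂ (inj₁ refl) , all = contradiction (penultimate P) ~-irrefl
    ...   | e , l , P , inj₂ (inj₂ refl) , all = contradiction (penultimate P) ¬x~y
    ...   | e , l , P , inj₁ e∈ , all = e , e∈ , penultimate P , λ {p} p∉ p~x p~y →
      fan-path P p~x p~y (All.map (λ { (inj₁ v∈) refl → p∉ v∈ ; (inj₂ (inj₁ v≡y)) refl → ~⇒≢ p~y v≡y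
                                      ; (inj₂ (inj₂ v≡x)) refl → ~⇒≢ p~x v≡x }) all)

-- The forbidden graph, cliques, and operations on decompositions.

-- Since vertices are determined by their neighbourhoods here, any map that preserves adjacency and
-- non-adjacency is injective.
coClaw-rows-distinct : ∀ i j → (∀ k → coClaw2P1Adj i k ≡ coClaw2P1Adj j k) → i ≡ j
coClaw-rows-distinct = from-yes (all? λ i → all? λ j → all?
    (λ k → coClaw2P1Adj i k ≟ᵇ coClaw2P1Adj j k) →-dec (i Fin.≟ j))

coClaw-sym : ∀ i j → coClaw2P1Adj i j ≡ coClaw2P1Adj j i
coClaw-sym = from-yes (all? λ i → all? λ j → coClaw2P1Adj i j ≟ᵇ coClaw2P1Adj j i)

module Structure (G : Graph) where
  open Decomposition G
  open Paths G

  module _ (free : Free 6 coClaw2P1Adj G) where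

    -- In the complement, w is the centre of the claw, a, b, c are its leaves, and p, q are the
    -- isolated vertices.
    no-coClaw : ∀ {w a b c p q} → ¬ w ~ a → ¬ w ~ b → ¬ w ~ c → w ~ p → w ~ q →
                a ~ b → a ~ c → b ~ c → a ~ p → b ~ p → c ~ p → a ~ q → b ~ q → c ~ q → p ~ q → Absurd
    no-coClaw {w} {a} {b} {c} {p} {q} ¬wa ¬wb ¬wc wp wq ab ac bc ap bp cp aq bq cq pq =
        free (f , (λ {i} {j} → inj {i} {j}) , adjs)
      where
      f : Fin 6 → V
      f = Vec.lookup (w ∷ a ∷ b ∷ c ∷ p ∷ q ∷ [])
      upper : ∀ i j → i Fin.< j → coClaw2P1Adj i j ≡ adj G (f i) (f j)
      upper zero (suc zero) _ = sym (≁⇒false ¬wa)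
      upper zero (suc (suc zero)) _ = sym (≁⇒false ¬wb)
      upper zero (suc (suc (suc zero))) _ = sym (≁⇒false ¬wc)
      upper zero (suc (suc (suc (suc zero)))) _ = sym wp
      upper zero (suc (suc (suc (suc (suc zero))))) _ = sym wq
      upper (suc zero) (suc (suc zero)) _ = sym ab
      upper (suc zero) (suc (suc (suc zero))) _ = sym ac
      upper (suc zero) (suc (suc (suc (suc zero)))) _ = sym ap
      upper (suc zero) (suc (suc (suc (suc (suc zero))))) _ = sym aq
      upper (suc (suc zero)) (suc (suc (suc zero))) _ = sym bc
      upper (suc (suc zero)) (suc (suc (suc (suc zero)))) _ = sym bp
      upper (suc (suc zero)) (suc (suc (suc (suc (suc zero))))) _ = sym bq
      upper (suc (suc (suc zero))) (suc (suc (suc (suc zero)))) _ = sym cp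
      upper (suc (suc (suc zero))) (suc (suc (suc (suc (suc zero))))) _ = sym cq
      upper (suc (suc (suc (suc zero)))) (suc (suc (suc (suc (suc zero))))) _ = sym pq
      upper (suc zero) (suc zero) (s≤s ())
      upper (suc (suc _)) (suc zero) (s≤s ())
      upper (suc (suc zero)) (suc (suc zero)) (s≤s (s≤s ()))
      upper (suc (suc (suc _))) (suc (suc zero)) (s≤s (s≤s ()))
      upper (suc (suc (suc zero))) (suc (suc (suc zero))) (s≤s (s≤s (s≤s ())))
      upper (suc (suc (suc (suc _)))) (suc (suc (suc zero))) (s≤s (s≤s (s≤s ())))
      upper (suc (suc (suc (suc zero)))) (suc (suc (suc (suc zero)))) (s≤s (s≤s (s≤s (s≤s ()))))
      upper (suc (suc (suc (suc (suc zero))))) (suc (suc (suc (suc zero)))) (s≤s (s≤s (s≤s (s≤s ()))))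
      upper (suc (suc (suc (suc (suc zero))))) (suc (suc (suc (suc (suc zero)))))
          (s≤s (s≤s (s≤s (s≤s (s≤s ())))))
      diagonal : ∀ i → coClaw2P1Adj i i ≡ false
      diagonal = from-yes (all? λ i → coClaw2P1Adj i i ≟ᵇ false)
      adjs : ∀ i j → coClaw2P1Adj i j ≡ adj G (f i) (f j)
      adjs i j with <-cmp i j
      ... | tri< i<j _ _ = upper i j i<j
      ... | tri≈ _ refl _ = trans (diagonal i) (sym (adj-irrefl G (f i)))
      ... | tri> _ _ j<i = trans (coClaw-sym i j) (trans (upper j i j<i) (adj-sym G _ _))
      inj : ∀ {i j} → f i ≡ f j → i ≡ j
      inj {i} {j} eq = coClaw-rows-distinct i j λ k →
        trans (adjs i k) (trans (cong (λ v → adj G v (f k)) eq) (sym (adjs j k)))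

  Clique : Subset (n G) → Set
  Clique K = ∀ {x y} → x ∈ K → y ∈ K → x ≢ y → x ~ y

  clique-∪ : ∀ {K v} → Clique K → (∀ {x} → x ∈ K → v ~ x) → Clique (K ∪ ⁅ v ⁆)
  clique-∪ cl v~ x∈ y∈ x≢y with ∪⁻ x∈ | ∪⁻ y∈
  ... | inj₁ x∈K | inj₁ y∈K = cl x∈K y∈K x≢y
  ... | inj₁ x∈K | inj₂ y≡v with ⁅⁆⁻ y≡v
  ...   | refl = ~-sym (v~ x∈K)
  clique-∪ cl v~ x∈ y∈ x≢y | inj₂ x≡v | inj₁ y∈K with ⁅⁆⁻ x≡v
  ...   | refl = v~ y∈K
  clique-∪ cl v~ x∈ y∈ x≢y | inj₂ x≡v | inj₂ y≡v = contradiction (trans (⁅⁆⁻ x≡v) (sym (⁅⁆⁻ y≡v))) x≢y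

  -- The ambient set matters only through the edges leaving X, so exchanging it costs no bits when U
  -- already contains all neighbours of X in U′.
  lift : ∀ {m U U′ X} → Decomp m U X → (∀ {x y} → x ∈ X → y ∈ U′ → x ~ y → y ∈ U) → Decomp m U′ X
  lift (empty ∉X) _ = empty ∉X
  lift (leaf z z∈ only) _ = leaf z z∈ only
  lift (node D₁ D₂ disj X⊆Z Y⊆Z split T) near =
    node (lift D₁ (near ∘ X⊆Z)) (lift D₂ (near ∘ Y⊆Z)) disj X⊆Z Y⊆Z split record
      { bits = bits ; few = few ; live = live
      ; dead = λ x∈ x∉ y∈ y∉ x~y → dead x∈ x∉ (near x∈ y∈ x~y) y∉ x~y
      ; same = λ x∈ x′∈ l l′ ag y∈ y∉ x~y → same x∈ x′∈ l l′ ag (near x∈ y∈ x~y) y∉ x~y }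
    where open Typed T

  -- The bits `cs` account for the new neighbours. One further bit remembers the old `live`, because
  -- vertices that were dead towards U may have neighbours in U′.
  refine : ∀ {m k U U′ X} (cs : List (V → Bool)) → suc (length cs) + m ≤ k → Decomp m U X →
           (∀ {x x′ y} → x ∈ X → x′ ∈ X → Agree cs x x′ → y ∈ U′ → y ∉ U → x ~ y → x′ ~ y) →
               Decomp k U′ X
  refine cs le (empty ∉X) _ = empty ∉X
  refine cs le (leaf z z∈ only) _ = leaf z z∈ only
  refine {m} {k} {U} {U′} cs le (node {Z = Z} D₁ D₂ disj X⊆Z Y⊆Z split T) new =
    node (refine cs le D₁ λ x∈ x′∈ → new (X⊆Z x∈) (X⊆Z x′∈))
        (refine cs le D₂ λ x∈ x′∈ → new (Y⊆Z x∈) (Y⊆Z x′∈))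
      disj X⊆Z Y⊆Z split record
      { bits = alive ∷ cs ++ bits
      ; few = ≤-trans (≤-reflexive (cong suc (length-++ cs)))
          (≤-trans (s≤s (+-monoʳ-≤ (length cs) few)) le)
      ; live = ⊤ ; dead = λ _ x∉ _ _ _ → x∉ ∈⊤
      ; same = λ { {x} {x′} {y} x∈ x′∈ _ _ (b ∷ ag) y∈ y∉ x~y →
          same′ x∈ x′∈ b (++⁻ˡ cs ag) (++⁻ʳ cs ag) y∈ y∉ x~y } }
    where
    open Typed T
    alive : V → Bool
    alive x = does (x ∈? live)
    same′ : ∀ {x x′ y} → x ∈ Z → x′ ∈ Z → alive x ≡ alive x′ → Agree cs x x′ → Agree bits x x′ →
        y ∈ U′ → y ∉ Z → x ~ y → x′ ~ y
    same′ {x} {x′} {y} x∈ x′∈ b ag ag′ y∈ y∉ x~y with y ∈? U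
    ... | no y∉U = new x∈ x′∈ ag y∈ y∉U x~y
    ... | yes y∈U with x ∈? live | x′ ∈? live
    ...   | yes l | yes l′ = same x∈ x′∈ l l′ ag′ y∈U y∉ x~y
    ...   | no ¬l | no _ = contradiction x~y (dead x∈ ¬l y∈U y∉)
    same′ {x} {x′} {y} x∈ x′∈ () ag ag′ y∈ y∉ x~y | yes y∈U | yes _ | no _
    same′ {x} {x′} {y} x∈ x′∈ () ag ag′ y∈ y∉ x~y | yes y∈U | no _ | yes _

  -- Each vertex of A costs one bit, namely adjacency to it; `cs` only has to settle the neighbours
  -- outside A.
  typed-by : ∀ {m U X} (A : Subset (n G)) (cs : List (V → Bool)) → ∣ A ∣ + length cs ≤ m →
             (∀ {x x′ y} → x ∈ X → x′ ∈ X → Agree cs x x′ → y ∈ U → y ∉ X → y ∉ A → x ~ y →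
                 x′ ~ y) → Typed m U X
  typed-by {m} {U} {X} A cs le s = record
    { bits = map (adj G) as ++ cs
    ; few = ≤-trans (≤-reflexive (trans (length-++ (map (adj G) as))
        (cong (_+ length cs) (length-map (adj G) as))))
              (≤-trans (+-monoˡ-≤ (length cs) few-as) le)
    ; live = ⊤ ; dead = λ _ x∉ _ _ _ → x∉ ∈⊤
    ; same = λ x∈ x′∈ _ _ ag y∈ y∉ x~y → same x∈ x′∈ (++⁻ˡ (map (adj G) as) ag)
        (++⁻ʳ (map (adj G) as) ag) y∈ y∉ x~y }
    where
    as = proj₁ (elements A)
    few-as = proj₁ (proj₂ (elements A))
    same : ∀ {x x′ y} → x ∈ X → x′ ∈ X → Agree (map (adj G) as) x x′ → Agree cs x x′ → y ∈ U →
        y ∉ X → x ~ y → x′ ~ y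
    same {x} {x′} {y} x∈ x′∈ ag ag′ y∈ y∉ x~y with y ∈? A
    ... | no y∉A = s x∈ x′∈ ag′ y∈ y∉ y∉A x~y
    ... | yes y∈A = ~-sym (trans (sym (All.lookup (map⁻ ag) (proj₂ (proj₂ (elements A)) y∈A)))
        (~-sym x~y))

  insert : ∀ {m U X Z} v → Decomp m U X → v ∉ X → X ⊆ Z → v ∈ Z → (∀ {x} → x ∈ Z → x ∈ X ⊎ x ≡ v) →
      Typed m U Z → Decomp m U Z
  insert {X = X} {Z} v D v∉ X⊆Z v∈ split T = node D (leaf v ⁅⁆⁺ ⁅⁆⁻)
      (λ x∈ x∈v → v∉ (subst (_∈ X) (⁅⁆⁻ x∈v) x∈)) X⊆Z
    (λ i → subst (_∈ Z) (sym (⁅⁆⁻ i)) v∈) (λ i → [ inj₁ , (λ { refl → inj₂ ⁅⁆⁺ }) ] (split i)) T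

  -- The vertices of E, whose neighbours outside E are all equal to z, become dead as soon as
  -- they are joined to z, so no node needs more bits than before.
  prune : ∀ {m U X E z Z} → Decomp m (U ─ E) X → X ⊆ U → Disjoint X E →
          (∀ {x y} → x ∈ E → y ∈ U → y ∉ E → x ~ y → y ≡ z) → Decomp m U E →
          z ∈ X → X ⊆ Z → E ⊆ Z → (∀ {x} → x ∈ Z → x ∈ X ⊎ x ∈ E) → Decomp m U Z
  prune (empty ∉X) _ _ _ _ z∈ _ _ _ = contradiction z∈ ∉X
  prune {m} {U} {X} {E} {z} {Z} (leaf z′ z′∈ only-z′) _ disj only DE z∈ X⊆Z E⊆Z split =
    node (leaf z z∈ only-z) DE disj X⊆Z E⊆Z split record
      -- Once E is joined to z, only z can have neighbours further out.
      { bits = [] ; few = z≤n ; live = ⁅ z ⁆ ; dead = dead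
      ; same = λ _ _ l l′ _ _ _ x~y → subst (_~ _) (trans (⁅⁆⁻ l) (sym (⁅⁆⁻ l′))) x~y }
    where
    only-z : ∀ {x} → x ∈ X → x ≡ z
    only-z x∈ = trans (only-z′ x∈) (sym (only-z′ z∈))
    dead : ∀ {x y} → x ∈ Z → x ∉ ⁅ z ⁆ → y ∈ U → y ∉ Z → ¬ x ~ y
    dead x∈ x∉ y∈ y∉ x~y with split x∈
    ... | inj₁ x∈X = x∉ (subst (_∈ ⁅ z ⁆) (sym (only-z x∈X)) ⁅⁆⁺)
    ... | inj₂ x∈E = y∉ (subst (_∈ Z) (sym (only x∈E y∈ (y∉ ∘ E⊆Z) x~y)) (X⊆Z z∈))
  prune {m} {U} {X} {E} {z} {Z} (node {X = X₁} {Y = X₂} D₁ D₂ disj₁₂ X₁⊆ X₂⊆ split₁₂ T) X⊆U disj only DE z∈ X⊆Z E⊆Z split =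
    -- E is carried down into the child containing z; the other child has no edge to E and is merely
    -- lifted.
    [ (λ z∈₁ → node (prune D₁ (X⊆U ∘ X₁⊆) (disj ∘ X₁⊆) only DE z∈₁ ∪ˡ ∪ʳ ∪⁻)
                    (lift D₂ (unrelated X₂⊆ λ z∈₂ → disj₁₂ z∈₁ z∈₂))
                    (λ i j → [ (λ i₁ → disj₁₂ i₁ j) , disj (X₂⊆ j) ] (∪⁻ i))
                    (λ i → [ X⊆Z ∘ X₁⊆ , E⊆Z ] (∪⁻ i)) (X⊆Z ∘ X₂⊆)
                    (λ i → [ (λ i′ → [ inj₁ ∘ ∪ˡ , inj₂ ] (split₁₂ i′)) , inj₁ ∘ ∪ʳ ] (split i)) typed)
    , (λ z∈₂ → node (lift D₁ (unrelated X₁⊆ λ z∈₁ → disj₁₂ z∈₁ z∈₂))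
                    (prune D₂ (X⊆U ∘ X₂⊆) (disj ∘ X₂⊆) only DE z∈₂ ∪ˡ ∪ʳ ∪⁻)
                    (λ i j → [ disj₁₂ i , disj (X₁⊆ i) ] (∪⁻ j))
                    (X⊆Z ∘ X₁⊆) (λ i → [ X⊆Z ∘ X₂⊆ , E⊆Z ] (∪⁻ i))
                    (λ i → [ (λ i′ → [ inj₁ , inj₂ ∘ ∪ˡ ] (split₁₂ i′)) , inj₂ ∘ ∪ʳ ] (split i)) typed)
    ] (split₁₂ z∈)
    where
    open Typed T renaming (dead to dead₀; same to same₀)
    unrelated : ∀ {X′} → X′ ⊆ X → z ∉ X′ → ∀ {x y} → x ∈ X′ → y ∈ U → x ~ y → y ∈ U ─ E
    unrelated {X′} sub z∉ x∈ y∈ x~y =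
      ─⁺ y∈ λ y∈E → z∉ (subst (_∈ X′) (only y∈E (X⊆U (sub x∈)) (disj (sub x∈)) (~-sym x~y)) x∈)
    dead : ∀ {x y} → x ∈ Z → x ∉ live ─ E → y ∈ U → y ∉ Z → ¬ x ~ y
    dead x∈ x∉ y∈ y∉ x~y with split x∈
    ... | inj₁ x∈X = dead₀ x∈X (λ l → x∉ (─⁺ l (disj x∈X))) (─⁺ y∈ (y∉ ∘ E⊆Z)) (y∉ ∘ X⊆Z) x~y
    ... | inj₂ x∈E = y∉ (subst (_∈ Z) (sym (only x∈E y∈ (y∉ ∘ E⊆Z) x~y)) (X⊆Z z∈))
    in-X : ∀ {x} → x ∈ Z → x ∈ live ─ E → x ∈ X
    in-X x∈ l = [ id , (λ x∈E → ⊥-elim (─∉ l x∈E)) ] (split x∈)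
    typed : Typed m U Z
    typed = record
      { bits = bits ; few = few ; live = live ─ E ; dead = dead
      ; same = λ x∈ x′∈ l l′ ag y∈ y∉ x~y →
          same₀ (in-X x∈ l) (in-X x′∈ l′) (─⊆ l) (─⊆ l′) ag (─⁺ y∈ (y∉ ∘ E⊆Z)) (y∉ ∘ X⊆Z) x~y }

-- Connected components and the recursion over an attaching clique.

module Components (G : Graph) where
  open Decomposition G
  open Paths G
  open Structure G

  component : ∀ {C v} → v ∈ C →
              ∃[ D ] (D ⊆ C × v ∈ D × Connected D × (∀ {x y} → x ∈ D → y ∈ C → x ~ y → y ∈ D))
  component {C} {v} v∈C = grow (suc ∣ C ─ ⁅ v ⁆ ∣) ⁅ v ⁆ (n<1+n _)
      (λ i → subst (_∈ C) (sym (⁅⁆⁻ i)) v∈C) ⁅⁆⁺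
    λ i → subst (λ x → Walk ⁅ v ⁆ x v) (sym (⁅⁆⁻ i)) (stop ⁅⁆⁺)
    where
    grow : ∀ k D → ∣ C ─ D ∣ < k → D ⊆ C → v ∈ D → (∀ {x} → x ∈ D → Walk D x v) →
           ∃[ D ] (D ⊆ C × v ∈ D × Connected D × (∀ {x y} → x ∈ D → y ∈ C → x ~ y → y ∈ D))
    grow (suc k) D (s≤s lt) D⊆C v∈D walks
      with any? (λ x → any? λ y → (x ∈? D) ×-dec (y ∈? C) ×-dec ¬? (y ∈? D) ×-dec (x ~? y))
    ... | no closed = D , D⊆C , v∈D , (λ x∈ y∈ → walks x∈ ++ʷ reverse (walks y∈)) ,
          λ {x} {y} x∈ y∈ x~y → decidable-stable (y ∈? D) λ y∉ → closed (x , y , x∈ , y∈ , y∉ , x~y)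
    ... | yes (x , y , x∈ , y∈ , y∉ , x~y) = grow k (D ∪ ⁅ y ⁆)
      (≤-trans (∣∣-mono-< (λ i → ─⁺ (─⊆ i) (─∉ i ∘ ∪ˡ)) (─⁺ y∈ y∉) (λ i → ─∉ i (∪ʳ ⁅⁆⁺))) lt)
      (λ i → [ D⊆C , (λ j → subst (_∈ C) (sym (⁅⁆⁻ j)) y∈) ] (∪⁻ i)) (∪ˡ v∈D)
      λ i → [ (λ j → walk-mono ∪ˡ (walks j))
            , (λ j → subst (λ z → Walk (D ∪ ⁅ y ⁆) z v) (sym (⁅⁆⁻ j))
                       (step (∪ʳ ⁅⁆⁺) (~-sym x~y) (walk-mono ∪ˡ (walks x∈)))) ] (∪⁻ i)

  module _ (chordal : Chordal G) where

    touches? : ∀ v C → Dec (Touches v C)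
    touches? v C = any? λ c → (c ∈? C) ×-dec (v ~? c)

    -- The vertices of Q are handled one by one. If the current c is not adjacent to q, then `fan`
    -- supplies a neighbour e of q in C; the vertices handled before are common neighbours of c and
    -- q, hence adjacent to e as well.
    complete : ∀ {C Q v} → v ∈ C → Connected C → Clique Q → Disjoint C Q →
        (∀ {q} → q ∈ Q → Touches q C) →
               ∃[ c ] (c ∈ C × (∀ {q} → q ∈ Q → c ~ q))
    complete {C} {Q} {v} v∈C con cl disj touch =
      let c , c∈ , all = go (proj₁ elems) in c , c∈ , λ q∈ → All.lookup all (proj₂ (proj₂ elems) q∈) q∈
      where
      elems = elements Q
      go : (qs : List V) → ∃[ c ] (c ∈ C × All (λ q → q ∈ Q → c ~ q) qs)
      go [] = v , v∈C , []
      go (q ∷ qs) with go qs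
      ... | c , c∈ , all with q ∈? Q | c ~? q
      ...   | no q∉ | _ = c , c∈ , (λ q∈ → contradiction q∈ q∉) ∷ all
      ...   | yes _ | yes c~q = c , c∈ , (λ _ → c~q) ∷ all
      ...   | yes q∈ | no ¬c~q
        with fan chordal con (λ { refl → disj c∈ q∈ }) ¬c~q (λ q∈C → disj q∈C q∈) (inj₁ c∈) (touch q∈)
      ...     | e , e∈ , e~q , common = e , e∈ , (λ _ → e~q) ∷ All.map upgrade all
        where
        upgrade : ∀ {p} → (p ∈ Q → c ~ p) → p ∈ Q → e ~ p
        upgrade {p} c~p p∈ with p Fin.≟ q
        ... | yes refl = e~q
        ... | no p≢q = ~-sym (common (λ p∈C → disj p∈C p∈) (~-sym (c~p p∈)) (cl p∈ q∈ p≢q))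

    module Recursion {t m : ℕ} (t≤m : t ≤ m) (F : Subset (n G)) where

      -- F confines C and Q, so that a property of F, such as having no triangle, is available in
      -- `Step`.
      Decomposable : ℕ → Set
      Decomposable k = ∀ {C Q} → ∣ C ∣ < k → Clique Q → Q ⊆ F → C ⊆ F → Disjoint C Q → ∣ Q ∣ ≤ t →
          Decomp m (Q ∪ C) C

      -- The case left to the user of the recursion: the clique already has t vertices, so the
      -- vertex v complete to it cannot be moved there.
      Step : Set
      Step = ∀ {C Q v} → Clique Q → Q ⊆ F → C ⊆ F → Disjoint C Q → ∣ Q ∣ ≡ t → v ∈ C →
          (∀ {q} → q ∈ Q → v ~ q) →
             Decomposable ∣ C ∣ → Decomp m (Q ∪ C) C

      attached : ∀ {C Q} → ∣ Q ∣ ≤ t → Typed m (Q ∪ C) C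
      attached {C} {Q} le = typed-by Q [] (≤-trans (≤-reflexive (+-identityʳ ∣ Q ∣)) (≤-trans le t≤m))
        λ _ _ _ y∈ y∉C y∉Q _ → ⊥-elim ([ y∉Q , y∉C ] (∪⁻ y∈))

      decompose : Step → ∀ k → Decomposable k
      decompose big (suc k) {C} {Q} (s≤s C≤k) clQ Q⊆F C⊆F disj ∣Q∣≤t with nonempty? C
      ... | no ¬ne = empty λ i → ¬ne (_ , i)
      ... | yes (v , v∈) with component v∈
      ...   | D , D⊆C , v∈D , conD , closed with nonempty? (C ─ D)
      -- C is disconnected: D and the rest are decomposed separately, both attached to Q.
      ...     | yes (w , w∈) = node
        (lift (decompose big k (≤-trans (∣∣-mono-< D⊆C (─⊆ w∈) (─∉ w∈)) C≤k) clQ Q⊆F (C⊆F ∘ D⊆C)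
            (disj ∘ D⊆C) ∣Q∣≤t)
          λ x∈ y∈ x~y → [ ∪ˡ , (λ j → ∪ʳ (closed x∈ j x~y)) ] (∪⁻ y∈))
        (lift (decompose big k (≤-trans (∣∣-mono-< ─⊆ v∈ (λ i → ─∉ i v∈D)) C≤k) clQ Q⊆F (C⊆F ∘ ─⊆)
            (disj ∘ ─⊆) ∣Q∣≤t)
          λ x∈ y∈ x~y → [ ∪ˡ , (λ j → ∪ʳ (─⁺ j λ y∈D → ─∉ x∈ (closed y∈D (─⊆ x∈) (~-sym x~y)))) ]
              (∪⁻ y∈))
        (λ x∈D x∈ → ─∉ x∈ x∈D) D⊆C ─⊆ split (attached ∣Q∣≤t)
        where
        split : ∀ {x} → x ∈ C → x ∈ D ⊎ x ∈ C ─ D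
        split {x} x∈ with x ∈? D
        ... | yes x∈D = inj₁ x∈D
        ... | no x∉D = inj₂ (─⁺ x∈ x∉D)
      -- C is connected, and every vertex of `Q′` has a neighbour in C, as `complete` requires.
      ...     | no ¬rest with complete v∈ (λ x∈ y∈ → walk-mono D⊆C
          (conD (C⊆D x∈) (C⊆D y∈))) clQ′ disj′ (proj₂ ∘ ⟨⟩⁻)
        where
        C⊆D : C ⊆ D
        C⊆D {x} x∈ = decidable-stable (x ∈? D) λ x∉ → ¬rest (x , ─⁺ x∈ x∉)
        Q′ = ⟨ (λ q → (q ∈? Q) ×-dec touches? q C) ⟩
        clQ′ : Clique Q′
        clQ′ x∈ y∈ = clQ (proj₁ (⟨⟩⁻ x∈)) (proj₁ (⟨⟩⁻ y∈))
        disj′ : Disjoint C Q′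
        disj′ x∈ = disj x∈ ∘ proj₁ ∘ ⟨⟩⁻
      ...       | c , c∈ , c~ = finish (m≤n⇒m<n∨m≡n (≤-trans (∣∣-mono Q′⊆Q) ∣Q∣≤t))
        where
        Q′ = ⟨ (λ q → (q ∈? Q) ×-dec touches? q C) ⟩
        Q′⊆Q : Q′ ⊆ Q
        Q′⊆Q = proj₁ ∘ ⟨⟩⁻
        clQ′ : Clique Q′
        clQ′ x∈ y∈ = clQ (Q′⊆Q x∈) (Q′⊆Q y∈)
        finish : ∣ Q′ ∣ < t ⊎ ∣ Q′ ∣ ≡ t → Decomp m (Q ∪ C) C
        finish (inj₂ ∣Q′∣≡t) = lift
          (big clQ′ (Q⊆F ∘ Q′⊆Q) C⊆F (λ x∈ → disj x∈ ∘ Q′⊆Q) ∣Q′∣≡t c∈ c~ λ lt →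
              decompose big k (<-≤-trans lt C≤k))
          λ x∈ y∈ x~y → [ (λ y∈Q → ∪ˡ (⟨⟩⁺ (y∈Q , _ , x∈ , ~-sym x~y))) , ∪ʳ ] (∪⁻ y∈)
        -- There is room for c in the clique: the rest of C is decomposed as attached to `Q′` and c,
        -- and c itself becomes the last leaf.
        finish (inj₁ ∣Q′∣<t) = insert c
          (lift (decompose big k (<-≤-trans (∣∣-mono-< ─⊆ c∈ (λ i → ─∉ i ⁅⁆⁺)) C≤k) (clique-∪ clQ′ c~)
                  (λ i → [ Q⊆F ∘ Q′⊆Q , (λ j → subst (_∈ F) (sym (⁅⁆⁻ j)) (C⊆F c∈)) ] (∪⁻ i)) (C⊆F ∘ ─⊆)
                  (λ x∈ i → [ disj (─⊆ x∈) ∘ Q′⊆Q , ─∉ x∈ ] (∪⁻ i)) (≤-trans (∣∪⁅⁆∣ Q′ c) ∣Q′∣<t)) near)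
          (λ i → ─∉ i ⁅⁆⁺) ─⊆ c∈ split (attached ∣Q∣≤t)
          where
          near : ∀ {x y} → x ∈ C ─ ⁅ c ⁆ → y ∈ Q ∪ C → x ~ y → y ∈ (Q′ ∪ ⁅ c ⁆) ∪ (C ─ ⁅ c ⁆)
          near {x} {y} x∈ y∈ x~y with ∪⁻ y∈ | y Fin.≟ c
          ... | inj₁ y∈Q | _ = ∪ˡ (∪ˡ (⟨⟩⁺ (y∈Q , _ , ─⊆ x∈ , ~-sym x~y)))
          ... | inj₂ y∈C | yes refl = ∪ˡ (∪ʳ ⁅⁆⁺)
          ... | inj₂ y∈C | no y≢c = ∪ʳ (─⁺ y∈C λ i → y≢c (⁅⁆⁻ i))
          split : ∀ {x} → x ∈ C → x ∈ C ─ ⁅ c ⁆ ⊎ x ≡ c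
          split {x} x∈ with x Fin.≟ c
          ... | yes eq = inj₂ eq
          ... | no x≢c = inj₁ (─⁺ x∈ λ i → x≢c (⁅⁆⁻ i))

-- Decomposition around a maximal clique that all vertices nearly dominate.

module Dense (G : Graph) where
  open Decomposition G
  open Paths G
  open Structure G
  open Components G

  -- The remaining vertices are added singly in an arbitrary order, which is why every intermediate
  -- set has to be typed.
  fill : ∀ {m U Z Z′} → Decomp m U Z → Z ⊆ Z′ → (∀ {Y} → Z ⊆ Y → Y ⊆ Z′ → Typed m U Y) → Decomp m U Z′
  fill {m} {U} {Z} {Z′} D Z⊆Z′ typed = go (suc ∣ Z′ ─ Z ∣) (n<1+n _) D id Z⊆Z′
    where
    go : ∀ k {Y} → ∣ Z′ ─ Y ∣ < k → Decomp m U Y → Z ⊆ Y → Y ⊆ Z′ → Decomp m U Z′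
    go (suc k) {Y} (s≤s lt) D Z⊆Y Y⊆Z′ with nonempty? (Z′ ─ Y)
    -- Y and `Z′` have the same elements; a node with an empty second child passes from one to the
    -- other.
    ... | no ¬ne = node D (empty {Z = ⊥} ∉⊥) (λ _ → ∉⊥) Y⊆Z′ (⊥-elim ∘ ∉⊥) all (typed (Y⊆Z′ ∘ Z⊆Y) id)
      where
      all : ∀ {x} → x ∈ Z′ → x ∈ Y ⊎ x ∈ ⊥
      all {x} x∈ = inj₁ (decidable-stable (x ∈? Y) λ x∉ → ¬ne (x , ─⁺ x∈ x∉))
    ... | yes (x , x∈) = go k (≤-trans (∣∣-mono-< (λ i → ─⁺ (─⊆ i) (─∉ i ∘ ∪ˡ)) x∈
        (λ i → ─∉ i (∪ʳ ⁅⁆⁺))) lt)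
      (insert x D (─∉ x∈) ∪ˡ (∪ʳ ⁅⁆⁺) (λ i → [ inj₁ , inj₂ ∘ ⁅⁆⁻ ] (∪⁻ i)) (typed (∪ˡ ∘ Z⊆Y) Y∪x⊆))
          (∪ˡ ∘ Z⊆Y) Y∪x⊆
      where
      Y∪x⊆ : Y ∪ ⁅ x ⁆ ⊆ Z′
      Y∪x⊆ i = [ Y⊆Z′ , (λ j → subst (_∈ Z′) (sym (⁅⁆⁻ j)) (─⊆ x∈)) ] (∪⁻ i)

  Miss : Subset (n G) → V → Subset (n G)
  Miss K v = ⟨ (λ k → (k ∈? K) ×-dec ¬? (v ~? k)) ⟩

  miss⊆ : ∀ {K v} → Miss K v ⊆ K
  miss⊆ = proj₁ ∘ ⟨⟩⁻

  miss-≁ : ∀ {K v k} → k ∈ Miss K v → ¬ v ~ k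
  miss-≁ = proj₂ ∘ ⟨⟩⁻

  hit : ∀ {K v k} → k ∈ K → k ∉ Miss K v → v ~ k
  hit {v = v} {k} k∈ k∉ = decidable-stable (v ~? k) λ ¬p → k∉ (⟨⟩⁺ (k∈ , ¬p))

  module _ (chordal : Chordal G) (free : Free 6 coClaw2P1Adj G) where

    -- In the recursion with t = 2, a `Step` would yield a triangle formed by v and the two vertices
    -- of the clique, so it never occurs.
    forest : ∀ {F} → (∀ {x y z} → x ∈ F → y ∈ F → z ∈ F → x ~ y → x ~ z → y ~ z → Absurd) → Decomp 2 F F
    forest {F} no-triangle = lift {U = ⊥ ∪ F}
      (decompose triangle-step (suc ∣ F ∣) (n<1+n _) (λ x∈ → ⊥-elim (∉⊥ x∈)) (⊥-elim ∘ ∉⊥) id (λ _ → ∉⊥)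
        (≤-trans (≤-reflexive (∣⊥∣≡0 (n G))) z≤n)) λ _ y∈ _ → ∪ʳ y∈
      where
      open Recursion chordal {2} {2} ≤-refl F
      triangle-step : Step
      triangle-step {Q = Q} cl Q⊆F C⊆F _ two v∈ v~ _ with pick₂ Q (≤-reflexive (sym two))
      ... | x , y , x∈ , y∈ , x≢y = ⊥-elim (no-triangle (C⊆F v∈) (Q⊆F x∈) (Q⊆F y∈) (v~ x∈) (v~ y∈)
          (cl x∈ y∈ x≢y))

    -- Three missed vertices together with p and q form a K₅ in which w has exactly the neighbours p
    -- and q.
    miss≤2 : ∀ {K w p q} → Clique K → p ∈ K → q ∈ K → p ≢ q → w ~ p → w ~ q → ∣ Miss K w ∣ ≤ 2
    miss≤2 {K} {w} {p} {q} cl p∈ q∈ p≢q w~p w~q with ∣ Miss K w ∣ ≤? 2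
    ... | yes le = le
    ... | no ¬le with pick₃ (Miss K w) (≰⇒> ¬le)
    ...   | a , b , c , a∈ , b∈ , c∈ , a≢b , a≢c , b≢c = ⊥-elim (no-coClaw free
      (miss-≁ a∈) (miss-≁ b∈) (miss-≁ c∈) w~p w~q
      (cl (miss⊆ a∈) (miss⊆ b∈) a≢b) (cl (miss⊆ a∈) (miss⊆ c∈) a≢c) (cl (miss⊆ b∈) (miss⊆ c∈) b≢c)
      (to p∈ w~p a∈) (to p∈ w~p b∈) (to p∈ w~p c∈) (to q∈ w~q a∈) (to q∈ w~q b∈) (to q∈ w~q c∈)
          (cl p∈ q∈ p≢q))
      where
      to : ∀ {p a} → p ∈ K → w ~ p → a ∈ Miss K w → a ~ p
      to p∈ w~p a∈ = cl (miss⊆ a∈) p∈ λ { refl → miss-≁ a∈ w~p }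

    module _ {K : Subset (n G)} (clK : Clique K) (8≤K : 8 ≤ ∣ K ∣) where

      shrink : ∀ {k} (R M : Subset (n G)) → 2 + k ≤ ∣ R ∣ → ∣ M ∣ ≤ 2 → k ≤ ∣ R ─ M ∣
      shrink {k} R M le M≤2 = +-cancelˡ-≤ 2 k _ (≤-trans le (≤-trans (∣∣≤∣─∣+ R M) (+-monoˡ-≤ _ M≤2)))

      opaque
        -- The three vertices together miss at most 6 of the at least 8 vertices of K.
        common : ∀ {x y z} → ∣ Miss K x ∣ ≤ 2 → ∣ Miss K y ∣ ≤ 2 → ∣ Miss K z ∣ ≤ 2 →
                 ∃[ p ] ∃[ q ] (p ∈ K × q ∈ K × p ≢ q × (x ~ p × y ~ p × z ~ p) ×
                     (x ~ q × y ~ q × z ~ q))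
        common {x} {y} {z} mx my mz
          with pick₂ (K ─ Miss K x ─ Miss K y ─ Miss K z)
              (shrink {2} _ _ (shrink {4} _ _ (shrink {6} _ _ 8≤K mx) my) mz)
        ... | p , q , p∈ , q∈ , p≢q = p , q , K∋ p∈ , K∋ q∈ , p≢q , hits p∈ , hits q∈
          where
          K∋ : ∀ {p} → p ∈ K ─ Miss K x ─ Miss K y ─ Miss K z → p ∈ K
          K∋ = ─⊆ ∘ ─⊆ ∘ ─⊆
          hits : ∀ {p} → p ∈ K ─ Miss K x ─ Miss K y ─ Miss K z → x ~ p × y ~ p × z ~ p
          hits i = hit (K∋ i) (─∉ (─⊆ (─⊆ i))) , hit (K∋ i) (─∉ (─⊆ i)) , hit (K∋ i) (─∉ i)

      module _ {U : Subset (n G)} (K⊆U : K ⊆ U) (miss-U : ∀ {u} → u ∈ U → ∣ Miss K u ∣ ≤ 2)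
               (maximal : ∀ {b} → b ∈ U → b ∉ K → ∃[ k ] k ∈ Miss K b) where

        B : Subset (n G)
        B = U ─ K

        miss-B : ∀ {b} → b ∈ B → ∣ Miss K b ∣ ≤ 2
        miss-B = miss-U ∘ ─⊆

        B≢K : ∀ {b k} → b ∈ B → k ∈ K → b ≢ k
        B≢K b∈ k∈ refl = ─∉ b∈ k∈

        -- If a were missed by u only and b by v only, then u, v, a, b would be an induced 4-cycle.
        nested : ∀ {u v} → u ∈ B → v ∈ B → u ~ v → Miss K u ⊆ Miss K v ⊎ Miss K v ⊆ Miss K u
        nested {u} {v} u∈ v∈ u~v with nonempty? (Miss K u ─ Miss K v) | nonempty? (Miss K v ─ Miss K u)
        ... | no ¬ne | _ = inj₁ λ {x} x∈ → decidable-stable (x ∈? Miss K v) λ x∉ → ¬ne (x , ─⁺ x∈ x∉)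
        ... | yes _ | no ¬ne = inj₂ λ {x} x∈ → decidable-stable (x ∈? Miss K u) λ x∉ → ¬ne (x , ─⁺ x∈ x∉)
        ... | yes (a , a∈) | yes (b , b∈) = ⊥-elim (C₄ chordal u~v v~a
            (clK a∈K b∈K λ { refl → miss-≁ (─⊆ b∈) v~a })
            (~-sym u~b) (B≢K u∈ a∈K) (miss-≁ (─⊆ a∈)) (B≢K v∈ b∈K) (miss-≁ (─⊆ b∈)))
          where
          a∈K = miss⊆ (─⊆ a∈)
          b∈K = miss⊆ (─⊆ b∈)
          v~a = hit a∈K (─∉ a∈)
          u~b = hit b∈K (─∉ b∈)

        -- With two common neighbours p, q in K, the triangle becomes a K₅ of which a sees only p
        -- and q.
        triangle : ∀ {u v w a} → a ∈ Miss K u → a ∈ Miss K v → a ∈ Miss K w → u ∈ B → v ∈ B → w ∈ B →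
                   u ~ v → u ~ w → v ~ w → Absurd
        triangle {u} {v} {w} {a} a∈u a∈v a∈w u∈ v∈ w∈ u~v u~w v~w with common (miss-B u∈)
            (miss-B v∈) (miss-B w∈)
        ... | p , q , p∈ , q∈ , p≢q , (u~p , v~p , w~p) , (u~q , v~q , w~q) =
          no-coClaw free (miss-≁ a∈u ∘ ~-sym) (miss-≁ a∈v ∘ ~-sym) (miss-≁ a∈w ∘ ~-sym) (a~ p∈ u~p)
              (a~ q∈ u~q)
            u~v u~w v~w u~p v~p w~p u~q v~q w~q (clK p∈ q∈ p≢q)
          where
          a~ : ∀ {p} → p ∈ K → u ~ p → a ~ p
          a~ p∈ u~p = clK (miss⊆ a∈u) p∈ λ { refl → miss-≁ a∈u u~p }

        -- The sets of missed vertices are nonempty and pairwise nested, hence have a common element.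
        no-triangle : ∀ {u v w} → u ∈ B → v ∈ B → w ∈ B → u ~ v → u ~ w → v ~ w → Absurd
        no-triangle u∈ v∈ w∈ u~v u~w v~w with nested u∈ v∈ u~v | nested u∈ w∈ u~w | nested v∈ w∈ v~w
        ... | inj₁ u⊆v | inj₁ u⊆w | _ = let a , a∈ = maximal (─⊆ u∈) (─∉ u∈) in
          triangle a∈ (u⊆v a∈) (u⊆w a∈) u∈ v∈ w∈ u~v u~w v~w
        ... | inj₁ u⊆v | inj₂ w⊆u | _ = let a , a∈ = maximal (─⊆ w∈) (─∉ w∈) in
          triangle (w⊆u a∈) (u⊆v (w⊆u a∈)) a∈ u∈ v∈ w∈ u~v u~w v~w
        ... | inj₂ v⊆u | _ | inj₁ v⊆w = let a , a∈ = maximal (─⊆ v∈) (─∉ v∈) in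
          triangle (v⊆u a∈) a∈ (v⊆w a∈) u∈ v∈ w∈ u~v u~w v~w
        ... | inj₂ v⊆u | _ | inj₂ w⊆v = let a , a∈ = maximal (─⊆ w∈) (─∉ w∈) in
          triangle (v⊆u (w⊆v a∈)) (w⊆v a∈) a∈ u∈ v∈ w∈ u~v u~w v~w

        -- A is a bounded set of exceptions, paid for with one bit per vertex. Away from A, a vertex
        -- of B has neighbours in B or misses a vertex of K, but not both.
        record Hub (A : Subset (n G)) : Set where
          field
            one-miss : ∀ {w c d} → w ∈ B → w ∉ A → c ∈ Miss K w → d ∈ Miss K w → c ∉ A → d ∉ A → c ≡ d
            isolated : ∀ {w w′ c} → w ∈ B → w′ ∈ B → w ∉ A → w′ ∉ A → w ~ w′ → c ∈ Miss K w → c ∈ A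

        module EdgeHub {u v} (u∈ : u ∈ B) (v∈ : v ∈ B) (u~v : u ~ v) (u⊆v : Miss K u ⊆ Miss K v)
                       {A} (v⊆A : Miss K v ⊆ A) (u∈A : u ∈ A) (v∈A : v ∈ A) where

          -- Otherwise u, v, c and two common neighbours in K form a K₅ in which w sees only the
          -- latter two.
          near : ∀ {w c} → w ∈ B → c ∈ Miss K w → c ∉ Miss K v → w ~ u ⊎ w ~ v
          near {w} {c} w∈ c∈w c∉v with w ~? u | w ~? v
          ... | yes w~u | _ = inj₁ w~u
          ... | no _ | yes w~v = inj₂ w~v
          ... | no ¬w~u | no ¬w~v with common (miss-B u∈) (miss-B v∈) (miss-B w∈)
          ...   | p , q , p∈ , q∈ , p≢q , (u~p , v~p , w~p) , (u~q , v~q , w~q) = ⊥-elim (no-coClaw free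
            ¬w~u ¬w~v (miss-≁ c∈w) w~p w~q u~v (hit c∈K (c∉v ∘ u⊆v)) (hit c∈K c∉v)
            u~p v~p (c~ p∈ w~p) u~q v~q (c~ q∈ w~q) (clK p∈ q∈ p≢q))
            where
            c∈K = miss⊆ c∈w
            c~ : ∀ {p} → p ∈ K → w ~ p → c ~ p
            c~ p∈ w~p = clK c∈K p∈ λ { refl → miss-≁ c∈w w~p }

          -- By nestedness and the choice of c, everything missed by s is missed by w, and s misses
          -- something because K is maximal.
          shared : ∀ {w s c} → w ∈ B → s ∈ B → w ~ s → Miss K s ⊆ Miss K v → c ∈ Miss K w →
              c ∉ Miss K v →
                   ∃[ a ] (a ∈ Miss K w × a ∈ Miss K v)
          shared w∈ s∈ w~s s⊆v c∈ c∉ with nested w∈ s∈ w~s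
          ... | inj₁ w⊆s = contradiction (s⊆v (w⊆s c∈)) c∉
          ... | inj₂ s⊆w = let a , a∈ = maximal (─⊆ s∈) (─∉ s∈) in a , s⊆w a∈ , s⊆v a∈

          -- Two misses outside A and the one provided by `shared` would be three.
          one-miss : ∀ {w c d} → w ∈ B → w ∉ A → c ∈ Miss K w → d ∈ Miss K w → c ∉ A → d ∉ A → c ≡ d
          one-miss {w} {c} {d} w∈ w∉ c∈ d∈ c∉ d∉ with c Fin.≟ d
          ... | yes eq = eq
          ... | no c≢d = contradiction (miss-B w∈) (<⇒≱ (three
              ([ (λ w~u → shared w∈ u∈ w~u u⊆v c∈ (c∉ ∘ v⊆A)) ,
                  (λ w~v → shared w∈ v∈ w~v id c∈ (c∉ ∘ v⊆A)) ]
              (near w∈ c∈ (c∉ ∘ v⊆A)))))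
            where
            three : ∃[ a ] (a ∈ Miss K w × a ∈ Miss K v) → 3 ≤ ∣ Miss K w ∣
            three (a , a∈w , a∈v) = 3≤∣∣ a∈w c∈ d∈ (λ { refl → c∉ (v⊆A a∈v) })
                (λ { refl → d∉ (v⊆A a∈v) }) c≢d

          -- Here s is an end of the edge uv adjacent to w, and s′ is the other end. If w′ sees s,
          -- there is a triangle in B; if it sees s′, then s′, s, w, w′ is an induced 4-cycle; if it
          -- sees c, then s, w, w′, c is one.
          isolated′ : ∀ {s s′ w w′ c} → s ∈ B → s′ ∈ B → s ~ s′ → s ∈ A → s′ ∈ A → Miss K s ⊆ Miss K v →
                      (w′ ~ s ⊎ w′ ~ s′ ⊎ c ∉ Miss K w′) →
                      w ∈ B → w′ ∈ B → w ∉ A → w′ ∉ A → w ~ w′ → c ∈ Miss K w → c ∉ Miss K v →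
                          w ~ s → Absurd
          isolated′ {s} {s′} {w} {w′} s∈ s′∈ s~s′ s∈A s′∈A s⊆v alt w∈ w′∈ w∉ w′∉ w~w′ c∈ c∉ w~s with w′ ~? s | alt
          ... | yes w′~s | _ = no-triangle s∈ w∈ w′∈ (~-sym w~s) (~-sym w′~s) w~w′
          ... | no ¬w′~s | inj₁ w′~s = ¬w′~s w′~s
          ... | no ¬w′~s | inj₂ (inj₂ c∉w′) = C₄ chordal (~-sym w~s) w~w′ (hit (miss⊆ c∈) c∉w′)
              (~-sym (hit (miss⊆ c∈) (c∉ ∘ s⊆v)))
            (λ { refl → w′∉ s∈A }) (¬w′~s ∘ ~-sym) (B≢K w∈ (miss⊆ c∈)) (miss-≁ c∈)
          ... | no ¬w′~s | inj₂ (inj₁ w′~s′) = C₄ chordal (~-sym s~s′) (~-sym w~s) w~w′ w′~s′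
            (λ { refl → w∉ s′∈A }) (λ s′~w → no-triangle s∈ s′∈ w∈ s~s′ (~-sym w~s) s′~w)
            (λ { refl → w′∉ s∈A }) (¬w′~s ∘ ~-sym)

          isolated : ∀ {w w′ c} → w ∈ B → w′ ∈ B → w ∉ A → w′ ∉ A → w ~ w′ → c ∈ Miss K w → c ∈ A
          isolated {w} {w′} {c} w∈ w′∈ w∉ w′∉ w~w′ c∈ = decidable-stable (c ∈? A) λ c∉A →
              absurd (c∉A ∘ v⊆A)
            where
            absurd : c ∉ Miss K v → Absurd
            absurd c∉ with near w∈ c∈ c∉ | c ∈? Miss K w′
            ... | inj₁ w~u | no c∉w′ = isolated′ u∈ v∈ u~v u∈A v∈A u⊆v
                (inj₂ (inj₂ c∉w′)) w∈ w′∈ w∉ w′∉ w~w′ c∈ c∉ w~u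
            ... | inj₂ w~v | no c∉w′ = isolated′ v∈ u∈ (~-sym u~v) v∈A u∈A id
                (inj₂ (inj₂ c∉w′)) w∈ w′∈ w∉ w′∉ w~w′ c∈ c∉ w~v
            ... | inj₁ w~u | yes c∈w′ = isolated′ u∈ v∈ u~v u∈A v∈A u⊆v
                ([ inj₁ , inj₂ ∘ inj₁ ] (near w′∈ c∈w′ c∉)) w∈ w′∈ w∉ w′∉ w~w′ c∈ c∉ w~u
            ... | inj₂ w~v | yes c∈w′ = isolated′ v∈ u∈ (~-sym u~v) v∈A u∈A id
                ([ inj₂ ∘ inj₁ , inj₁ ] (near w′∈ c∈w′ c∉)) w∈ w′∈ w∉ w′∉ w~w′ c∈ c∉ w~v

        edge-hub : ∀ {Q u v} → ∣ Q ∣ ≤ 8 → u ∈ B → v ∈ B → u ~ v → Miss K u ⊆ Miss K v →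
                   ∃[ A ] (Q ⊆ A × ∣ A ∣ ≤ 12 × Hub A)
        edge-hub {Q} {u} {v} Q≤8 u∈ v∈ u~v u⊆v = A , ∪ˡ , size ,
            record { one-miss = one-miss ; isolated = isolated }
          where
          A = Q ∪ (Miss K v ∪ (⁅ u ⁆ ∪ ⁅ v ⁆))
          -- 8 for Q, 2 for `Miss K v`, and 1 each for u and v.
          size : ∣ A ∣ ≤ 12
          size = ≤-trans (∣∪∣ Q _) (+-mono-≤ Q≤8 (≤-trans (∣∪∣ (Miss K v) _) (+-mono-≤ (miss-B v∈)
            (≤-trans (∣∪⁅⁆∣ ⁅ u ⁆ v) (≤-reflexive (cong suc (∣⁅⁆∣ u)))))))
          open EdgeHub u∈ v∈ u~v u⊆v {A} (∪ʳ ∘ ∪ˡ) (∪ʳ (∪ʳ (∪ˡ ⁅⁆⁺))) (∪ʳ (∪ʳ (∪ʳ ⁅⁆⁺)))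

        hub : ∀ {Q} → ∣ Q ∣ ≤ 8 → ∃[ A ] (Q ⊆ A × ∣ A ∣ ≤ 12 × Hub A)
        hub {Q} Q≤8 with any? (λ u → any? λ v → (u ∈? B) ×-dec (v ∈? B) ×-dec (u ~? v))
        ... | yes (u , v , u∈ , v∈ , u~v) =
          [ edge-hub Q≤8 u∈ v∈ u~v , edge-hub Q≤8 v∈ u∈ (~-sym u~v) ] (nested u∈ v∈ u~v)
        ... | no edgeless with nonempty? B
        ...   | no ¬ne = Q , id , ≤-trans Q≤8 (m≤m+n 8 4) , record
          { one-miss = λ w∈ → contradiction (_ , w∈) ¬ne ; isolated = λ w∈ → contradiction (_ , w∈) ¬ne }
        -- B has no edges, and any v in it serves: two misses c, d of w outside A would form a K₅
        -- with v and two common neighbours of v and w, which are all that w sees of it.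
        ...   | yes (v , v∈) = Q ∪ Miss K v , ∪ˡ ,
          ≤-trans (∣∪∣ Q _) (≤-trans (+-mono-≤ Q≤8 (miss-B v∈)) (m≤m+n 10 2)) , record
          { one-miss = one-miss ; isolated = λ w∈ w′∈ _ _ w~w′ _ →
              contradiction (_ , _ , w∈ , w′∈ , w~w′) edgeless }
          where
          one-miss : ∀ {w c d} → w ∈ B → w ∉ Q ∪ Miss K v → c ∈ Miss K w → d ∈ Miss K w →
                     c ∉ Q ∪ Miss K v → d ∉ Q ∪ Miss K v → c ≡ d
          one-miss {w} {c} {d} w∈ w∉ c∈ d∈ c∉ d∉ with c Fin.≟ d
          ... | yes eq = eq
          ... | no c≢d with common (miss-B v∈) (miss-B w∈) (miss-B w∈)
          ...   | p , q , p∈ , q∈ , p≢q , (v~p , w~p , _) , (v~q , w~q , _) = ⊥-elim (no-coClaw free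
            (λ w~v → edgeless (_ , _ , w∈ , v∈ , w~v)) (miss-≁ c∈) (miss-≁ d∈) w~p w~q
            (hit (miss⊆ c∈) (c∉ ∘ ∪ʳ)) (hit (miss⊆ d∈) (d∉ ∘ ∪ʳ)) (clK (miss⊆ c∈) (miss⊆ d∈) c≢d)
            v~p (to c∈ p∈ w~p) (to d∈ p∈ w~p) v~q (to c∈ q∈ w~q) (to d∈ q∈ w~q) (clK p∈ q∈ p≢q))
            where
            to : ∀ {c p} → c ∈ Miss K w → p ∈ K → w ~ p → c ~ p
            to c∈ p∈ w~p = clK (miss⊆ c∈) p∈ λ { refl → miss-≁ c∈ w~p }

        module Layout {A} (A≤12 : ∣ A ∣ ≤ 12) (hubA : Hub A) where
          open Hub hubA

          F : Subset (n G)
          F = ⟨ (λ b → (b ∈? B) ×-dec ¬? (b ∈? A) ×-dec ¬?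
              (any? λ c → (c ∈? Miss K b) ×-dec ¬? (c ∈? A))) ⟩

          -- For c in K outside A the blocks are disjoint by `one-miss`, and together with F they
          -- exhaust U outside A.
          Block : V → Subset (n G)
          Block c = ⟨ (λ x → (x ∈? U) ×-dec ¬? (x ∈? A) ×-dec
              ((x Fin.≟ c) ⊎-dec (¬? (x ∈? K) ×-dec (c ∈? Miss K x)))) ⟩

          F-or-miss : ∀ {b} → b ∈ B → b ∉ A → b ∈ F ⊎ ∃[ c ] (c ∈ Miss K b × c ∉ A)
          F-or-miss {b} b∈ b∉ with any? (λ c → (c ∈? Miss K b) ×-dec ¬? (c ∈? A))
          ... | yes found = inj₂ found
          ... | no none = inj₁ (⟨⟩⁺ (b∈ , b∉ , none))

          miss⇒block : ∀ {b c} → b ∈ B → b ∉ A → c ∈ Miss K b → b ∈ Block c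
          miss⇒block b∈ b∉ c∈ = ⟨⟩⁺ (─⊆ b∈ , b∉ , inj₂ (─∉ b∈ , c∈))

          -- By `no-triangle`, F is handled by `forest` with two bits. Outside F and A, all vertices
          -- of F have the same neighbours: all of K there, and by `isolated` nothing else.
          decomp-F : Decomp 16 U F
          decomp-F = refine (map (adj G) as) (+-monoˡ-≤ 2 (s≤s few-as))
            (forest λ x∈ y∈ z∈ → no-triangle (F⊆B x∈) (F⊆B y∈) (F⊆B z∈)) new
            where
            as = proj₁ (elements A)
            -- With the bit for `live` and the two bits of the forest, 13 gives the total of 16.
            few-as : length (map (adj G) as) ≤ 13
            few-as = ≤-trans (≤-reflexive (length-map (adj G) as))
                       (≤-trans (proj₁ (proj₂ (elements A))) (≤-trans A≤12 (n≤1+n 12)))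
            F⊆B : F ⊆ B
            F⊆B = proj₁ ∘ ⟨⟩⁻
            new : ∀ {x x′ y} → x ∈ F → x′ ∈ F → Agree (map (adj G) as) x x′ → y ∈ U → y ∉ F →
                x ~ y → x′ ~ y
            new {x} {x′} {y} x∈ x′∈ ag y∈ y∉ x~y with y ∈? A | y ∈? K
            ... | yes y∈A | _ = ~-sym (trans (sym (All.lookup (map⁻ ag)
                (proj₂ (proj₂ (elements A)) y∈A))) (~-sym x~y))
            ... | no y∉A | yes y∈K = hit y∈K λ y∈ → proj₂ (proj₂ (⟨⟩⁻ x′∈)) (y , y∈ , y∉A)
            ... | no y∉A | no y∉K with F-or-miss (─⁺ y∈ y∉K) y∉A
            ...   | inj₁ y∈F = contradiction y∈F y∉
            ...   | inj₂ (c , c∈ , c∉) = contradiction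
                (isolated (─⁺ y∈ y∉K) (F⊆B x∈) y∉A (proj₁ (proj₂ (⟨⟩⁻ x∈))) (~-sym x~y) c∈) c∉

          Closed : Subset (n G) → V → Set
          Closed Z c = ∀ {x} → x ∈ Block c → (c ∈ Z → x ∈ Z) × (x ∈ Z → c ∈ Z)

          record Stage (Z : Subset (n G)) : Set where
            field
              decomp : Decomp 16 U Z
              F⊆Z    : F ⊆ Z
              Z∩A    : Disjoint Z A
              Z⊆U    : Z ⊆ U
              closed : ∀ {c} → c ∈ K → c ∉ A → Closed Z c

          -- Only the block of c is incomplete in Z, and c is its first vertex.
          typed : ∀ {Z c} → F ⊆ Z → Disjoint Z A → Z ⊆ U →
              (∀ {c′} → c′ ∈ K → c′ ∉ A → c′ ≢ c → Closed Z c′) →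
                  (∀ {x} → x ∈ Block c → x ∈ Z → c ∈ Z) → Typed 16 U Z
          typed {Z} {c} F⊆Z Z∩A Z⊆U closed first =
            typed-by A bits (≤-trans (+-monoˡ-≤ 2 A≤12) (≤-trans (n≤1+n 14) (n≤1+n 15)))
              λ { {x} {x′} x∈ x′∈ (inK ∷ isc ∷ []) → same x∈ x′∈ (same-K {x} {x′} inK)
                  (same-c {x} {x′} isc) }
            where
            -- All of Z is complete to the vertices of K outside Z and A. A vertex y of U outside K,
            -- Z and A lies in a block, so its neighbours in Z are in K, and of these it can miss
            -- only c. Thus two bits, for K and for c, suffice.
            bits : List (V → Bool)
            bits = (λ x → does (x ∈? K)) ∷ (λ x → does (x Fin.≟ c)) ∷ []
            same-K : ∀ {x x′} → does (x ∈? K) ≡ does (x′ ∈? K) → x ∈ K → x′ ∈ K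
            same-K {x} {x′} eq x∈ with x ∈? K | x′ ∈? K
            ... | yes _ | yes x′∈ = x′∈
            ... | no x∉ | _ = contradiction x∈ x∉
            same-K {x} {x′} () x∈ | yes _ | no _
            same-c : ∀ {x x′} → does (x Fin.≟ c) ≡ does (x′ Fin.≟ c) → x′ ≡ c → x ≡ c
            same-c {x} {x′} eq x′≡c with x Fin.≟ c | x′ Fin.≟ c
            ... | yes x≡c | _ = x≡c
            ... | no _ | no x′≢c = contradiction x′≡c x′≢c
            same-c {x} {x′} () x′≡c | no _ | yes _
            closed⁻ : ∀ {x c′} → c′ ∈ K → c′ ∉ A → x ∈ Block c′ → x ∈ Z → c′ ∈ Z
            closed⁻ {c′ = c′} c′∈ c′∉ x∈ x∈Z with c′ Fin.≟ c
            ... | yes refl = first x∈ x∈Z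
            ... | no c′≢c = proj₂ (closed c′∈ c′∉ c′≢c x∈) x∈Z
            same : ∀ {x x′ y} → x ∈ Z → x′ ∈ Z → (x ∈ K → x′ ∈ K) → (x′ ≡ c → x ≡ c) →
                   y ∈ U → y ∉ Z → y ∉ A → x ~ y → x′ ~ y
            same {x} {x′} {y} x∈ x′∈ same-K same-c y∈ y∉Z y∉A x~y with y ∈? K | x′ ∈? K
            ... | yes y∈K | yes x′∈K = clK x′∈K y∈K λ { refl → y∉Z x′∈ }
            ... | yes y∈K | no x′∉K = hit y∈K λ m →
              y∉Z (closed⁻ y∈K y∉A (miss⇒block (─⁺ (Z⊆U x′∈) x′∉K) (Z∩A x′∈) m) x′∈)
            ... | no y∉K | x′∈?K with F-or-miss (─⁺ y∈ y∉K) y∉A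
            ...   | inj₁ y∈F = contradiction (F⊆Z y∈F) y∉Z
            ...   | inj₂ (d , d∈ , d∉) with x ∈? K
            ...     | no x∉K = contradiction (isolated (─⁺ y∈ y∉K) (─⁺ (Z⊆U x∈) x∉K) y∉A (Z∩A x∈)
                (~-sym x~y) d∈) d∉
            ...     | yes x∈K = decidable-stable (x′ ~? y) λ ¬x′~y → absurd ¬x′~y (x′ Fin.≟ c)
              where
              x′∈K : x′ ∈ K
              x′∈K = same-K x∈K
              absurd : ¬ x′ ~ y → Dec (x′ ≡ c) → Absurd
              absurd ¬x′~y (yes x′≡c) = ¬x′~y (subst (_~ y) (trans (same-c x′≡c) (sym x′≡c)) x~y)
              absurd ¬x′~y (no x′≢c) = y∉Z (proj₁ (closed x′∈K (Z∩A x′∈) x′≢c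
                (miss⇒block (─⁺ y∈ y∉K) y∉A (⟨⟩⁺ (x′∈K , ¬x′~y ∘ ~-sym)))) x′∈)

          start : Stage F
          start = record
            { decomp = decomp-F ; F⊆Z = id ; Z∩A = λ x∈ → proj₁ (proj₂ (⟨⟩⁻ x∈)) ; Z⊆U = ─⊆ ∘ proj₁ ∘ ⟨⟩⁻
            ; closed = λ {c} c∈ c∉ {x} x∈ → (λ c∈F → contradiction c∈ (─∉ (proj₁ (⟨⟩⁻ c∈F)))) ,
                λ x∈F → ⊥-elim (missed∉K x∈F c∉ (proj₂ (proj₂ (⟨⟩⁻ x∈))) c∈) }
            where
            missed∉K : ∀ {x c} → x ∈ F → c ∉ A → x ≡ c ⊎ (x ∉ K × c ∈ Miss K x) → c ∉ K
            missed∉K x∈F c∉ (inj₁ refl) c∈ = ─∉ (proj₁ (⟨⟩⁻ x∈F)) c∈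
            missed∉K x∈F c∉ (inj₂ (_ , m)) _ = proj₂ (proj₂ (⟨⟩⁻ x∈F)) (_ , m , c∉)

          block∩ : ∀ {x c c′} → c ∈ K → c ∉ A → c′ ∈ K → c′ ∉ A → x ∈ Block c → x ∈ Block c′ → c ≡ c′
          block∩ c∈ c∉ c′∈ c′∉ x∈ x∈′ with ⟨⟩⁻ x∈ | ⟨⟩⁻ x∈′
          ... | _ , _ , inj₁ refl | _ , _ , inj₁ refl = refl
          ... | _ , _ , inj₁ refl | _ , _ , inj₂ (x∉K , _) = contradiction c∈ x∉K
          ... | _ , _ , inj₂ (x∉K , _) | _ , _ , inj₁ refl = contradiction c′∈ x∉K
          ... | x∈U , x∉A , inj₂ (x∉K , m) | _ , _ , inj₂ (_ , m′) =
              one-miss (─⁺ x∈U x∉K) x∉A m m′ c∉ c′∉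

          add : ∀ {Z c} → Stage Z → c ∈ K → c ∉ A → ∃[ Z′ ] (Stage Z′ × Z ⊆ Z′ × c ∈ Z′)
          add {Z} {c} S c∈K c∉A with c ∈? Z
          ... | yes c∈Z = Z , S , id , c∈Z
          ... | no c∉Z = Z ∪ Block c , record
              -- First c is inserted, then the rest of its block in any order.
              { decomp = fill
                  (insert c decomp c∉Z ∪ˡ (∪ʳ ⁅⁆⁺) (λ i → [ inj₁ , inj₂ ∘ ⁅⁆⁻ ] (∪⁻ i))
                      (typed-between ∪ˡ (∪ʳ ⁅⁆⁺) first-step))
                  first-step (λ Z∪c⊆Y Y⊆ → typed-between (Z∪c⊆Y ∘ ∪ˡ) (Z∪c⊆Y (∪ʳ ⁅⁆⁺)) Y⊆)
              ; F⊆Z = ∪ˡ ∘ F⊆Z ; Z∩A = Z′∩A id ; Z⊆U = Z′⊆U id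
              ; closed = λ {c′} c′∈ c′∉ → closed′ c′∈ c′∉ } , ∪ˡ , ∪ʳ c∈Block
            where
            open Stage S
            c∈Block : c ∈ Block c
            c∈Block = ⟨⟩⁺ (K⊆U c∈K , c∉A , inj₁ refl)
            Z′∩A : ∀ {Y} → Y ⊆ Z ∪ Block c → Disjoint Y A
            Z′∩A Y⊆ y∈ = [ Z∩A , (λ i → proj₁ (proj₂ (⟨⟩⁻ i))) ] (∪⁻ (Y⊆ y∈))
            Z′⊆U : ∀ {Y} → Y ⊆ Z ∪ Block c → Y ⊆ U
            Z′⊆U Y⊆ y∈ = [ Z⊆U , proj₁ ∘ ⟨⟩⁻ ] (∪⁻ (Y⊆ y∈))
            first-step : Z ∪ ⁅ c ⁆ ⊆ Z ∪ Block c
            first-step i = [ ∪ˡ , (λ j → ∪ʳ (subst (_∈ Block c) (sym (⁅⁆⁻ j)) c∈Block)) ] (∪⁻ i)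
            others : ∀ {Y} → Z ⊆ Y → Y ⊆ Z ∪ Block c → ∀ {c′} → c′ ∈ K → c′ ∉ A → c′ ≢ c → Closed Y c′
            others Z⊆Y Y⊆ {c′} c′∈ c′∉ c′≢c {x} x∈ = (λ i →
                [ Z⊆Y ∘ proj₁ (closed c′∈ c′∉ x∈) , ⊥-elim ∘ c′∉Block ] (∪⁻ (Y⊆ i))) ,
              λ i → [ Z⊆Y ∘ proj₂ (closed c′∈ c′∉ x∈) , (λ j →
                  contradiction (block∩ c′∈ c′∉ c∈K c∉A x∈ j) c′≢c) ] (∪⁻ (Y⊆ i))
              where
              c′∉Block : c′ ∉ Block c
              c′∉Block i = c′≢c (block∩ c′∈ c′∉ c∈K c∉A (⟨⟩⁺ (K⊆U c′∈ , c′∉ , inj₁ refl)) i)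
            typed-between : ∀ {Y} → Z ⊆ Y → c ∈ Y → Y ⊆ Z ∪ Block c → Typed 16 U Y
            typed-between Z⊆Y c∈Y Y⊆ = typed (Z⊆Y ∘ F⊆Z) (Z′∩A Y⊆) (Z′⊆U Y⊆) (others Z⊆Y Y⊆) λ _ _ → c∈Y
            closed′ : ∀ {c′} → c′ ∈ K → c′ ∉ A → Closed (Z ∪ Block c) c′
            closed′ {c′} c′∈ c′∉ with c′ Fin.≟ c
            ... | yes refl = λ x∈ → (λ _ → ∪ʳ x∈) , (λ _ → ∪ʳ c∈Block)
            ... | no c′≢c = others ∪ˡ id c′∈ c′∉ c′≢c

          add-all : (cs : List V) → ∃[ Z ] (Stage Z × All (λ c → c ∈ K → c ∉ A → c ∈ Z) cs)
          add-all [] = F , start , []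
          add-all (c ∷ cs) with add-all cs | c ∈? K | c ∈? A
          ... | Z , S , all | no c∉ | _ = Z , S , (λ c∈ → contradiction c∈ c∉) ∷ all
          ... | Z , S , all | yes _ | yes c∈A = Z , S , (λ _ c∉A → contradiction c∈A c∉A) ∷ all
          ... | Z , S , all | yes c∈ | no c∉ with add S c∈ c∉
          ...   | Z′ , S′ , Z⊆Z′ , c∈Z′ = Z′ , S′ , (λ _ _ → c∈Z′) ∷ All.map (λ f i j → Z⊆Z′ (f i j)) all

          -- After all blocks are placed, only vertices of A are outstanding, and adjacency to A
          -- types every larger set.
          finish : ∀ {C} → C ⊆ U → (∀ {x} → x ∈ U → x ∉ A → x ∈ C) → Decomp 16 U C
          finish {C} C⊆U U─A⊆C with add-all (proj₁ (elements K))
          ... | Z , S , all = fill decomp (λ i → U─A⊆C (Z⊆U i) (Z∩A i)) λ Z⊆Y Y⊆C →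
            typed-by A [] (≤-trans (+-monoˡ-≤ 0 A≤12) (m≤m+n 12 4)) λ _ _ _ y∈ y∉Y y∉A →
                contradiction (Z⊆Y (rest∈ y∈ y∉A)) y∉Y
            where
            open Stage S
            K⊆Z : ∀ {c} → c ∈ K → c ∉ A → c ∈ Z
            K⊆Z c∈ c∉ = All.lookup all (proj₂ (proj₂ (elements K)) c∈) c∈ c∉
            rest∈ : ∀ {y} → y ∈ U → y ∉ A → y ∈ Z
            rest∈ {y} y∈ y∉ with y ∈? K
            ... | yes y∈K = K⊆Z y∈K y∉
            ... | no y∉K with F-or-miss (─⁺ y∈ y∉K) y∉
            ...   | inj₁ y∈F = F⊆Z y∈F
            ...   | inj₂ (c , c∈ , c∉) = proj₁ (closed (miss⊆ c∈) c∉ (miss⇒block (─⁺ y∈ y∉K) y∉ c∈))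
                (K⊆Z (miss⊆ c∈) c∉)

        dense : ∀ {Q C} → ∣ Q ∣ ≤ 8 → C ⊆ U → (∀ {x} → x ∈ U → x ∉ Q → x ∈ C) → Decomp 16 U C
        dense Q≤8 C⊆U U─Q⊆C with hub Q≤8
        ... | A , Q⊆A , A≤12 , hubA = Layout.finish A≤12 hubA C⊆U λ x∈ x∉ → U─Q⊆C x∈ (x∉ ∘ Q⊆A)

-- Splitting off vertices far from the clique, and the conclusion.

module Main (G : Graph) (chordal : Chordal G) (free : Free 6 coClaw2P1Adj G) where
  open Decomposition G
  open Paths G
  open Structure G
  open Components G
  open Dense G

  extend-clique : ∀ {Q U} → Clique Q → Q ⊆ U →
                  ∃[ K ] (Clique K × Q ⊆ K × K ⊆ U × (∀ {b} → b ∈ U → b ∉ K → ∃[ k ] k ∈ Miss K b))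
  extend-clique {Q} {U} cl Q⊆U = go (suc ∣ U ─ Q ∣) (n<1+n _) cl id Q⊆U
    where
    go : ∀ k {K} → ∣ U ─ K ∣ < k → Clique K → Q ⊆ K → K ⊆ U →
         ∃[ K ] (Clique K × Q ⊆ K × K ⊆ U × (∀ {b} → b ∈ U → b ∉ K → ∃[ k ] k ∈ Miss K b))
    go (suc k) {K} (s≤s lt) clK Q⊆K K⊆U with any? (λ b →
        (b ∈? U) ×-dec ¬? (b ∈? K) ×-dec ¬? (nonempty? (Miss K b)))
    ... | no none = K , clK , Q⊆K , K⊆U , λ {b} b∈ b∉ → decidable-stable
        (nonempty? (Miss K b)) λ ¬ne → none (b , b∈ , b∉ , ¬ne)
    ... | yes (b , b∈ , b∉ , ¬ne) = go k
      (≤-trans (∣∣-mono-< (λ i → ─⁺ (─⊆ i) (─∉ i ∘ ∪ˡ)) (─⁺ b∈ b∉) (λ i → ─∉ i (∪ʳ ⁅⁆⁺))) lt)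
      (clique-∪ clK λ x∈ → hit x∈ λ m → ¬ne (_ , m)) (∪ˡ ∘ Q⊆K)
      λ i → [ K⊆U , (λ j → subst (_∈ U) (sym (⁅⁆⁻ j)) b∈) ] (∪⁻ i)

  module _ {K U : Subset (n G)} (clK : Clique K) (8≤K : 8 ≤ ∣ K ∣) (K⊆U : K ⊆ U) where

    TwoIn : V → Set
    TwoIn v = ∃[ p ] ∃[ q ] (p ∈ K × q ∈ K × p ≢ q × v ~ p × v ~ q)

    twoIn? : ∀ v → Dec (TwoIn v)
    twoIn? v = any? λ p → any? λ q → (p ∈? K) ×-dec (q ∈? K) ×-dec ¬? (p Fin.≟ q) ×-dec
        (v ~? p) ×-dec (v ~? q)

    -- K together with the vertices having at least two neighbours in it.
    Core : Subset (n G)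
    Core = ⟨ (λ v → (v ∈? U) ×-dec twoIn? v) ⟩

    miss-core : ∀ {v} → v ∈ Core → ∣ Miss K v ∣ ≤ 2
    miss-core v∈ with proj₂ (⟨⟩⁻ v∈)
    ... | p , q , p∈ , q∈ , p≢q , v~p , v~q = miss≤2 chordal free clK p∈ q∈ p≢q v~p v~q

    K⊆Core : K ⊆ Core
    K⊆Core {k} k∈ with pick₂ (K ─ ⁅ k ⁆) (shrink chordal free clK 8≤K K ⁅ k ⁆ (≤-trans (m≤m+n 4 4) 8≤K)
                                            (≤-trans (≤-reflexive (∣⁅⁆∣ k)) (s≤s z≤n)))
    ... | p , q , p∈ , q∈ , p≢q = ⟨⟩⁺ (K⊆U k∈ , p , q , ─⊆ p∈ , ─⊆ q∈ , p≢q ,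
      clK k∈ (─⊆ p∈) (λ { refl → ─∉ p∈ ⁅⁆⁺ }) , clK k∈ (─⊆ q∈) (λ { refl → ─∉ q∈ ⁅⁆⁺ }))

    module _ {E : Subset (n G)} (con : Connected E) (E⊆U : E ⊆ U) (E∩Core : Disjoint E Core) where

      no-two : ∀ {e p q} → e ∈ E → p ∈ K → q ∈ K → p ≢ q → e ~ p → e ~ q → Absurd
      no-two e∈ p∈ q∈ p≢q e~p e~q = E∩Core e∈ (⟨⟩⁺ (E⊆U e∈ , _ , _ , p∈ , q∈ , p≢q , e~p , e~q))

      -- At least 8 - 2 - 2 vertices of K see both x and y, and with them form a clique. As e sees x
      -- and y, it misses at most two of that clique, so it has two neighbours in K and would lie in
      -- `Core`.
      edge-case : ∀ {x y e} → x ∈ Core → y ∈ Core → x ~ y → e ∈ E → e ~ x → e ~ y → Absurd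
      edge-case {x} {y} {e} x∈ y∈ x~y e∈ e~x e~y with pick₂ (R ─ Miss K′ e)
          (shrink chordal free clK 8≤K R (Miss K′ e) R≥4 e-miss)
        where
        R = K ─ Miss K x ─ Miss K y
        R≥4 : 4 ≤ ∣ R ∣
        R≥4 = shrink chordal free clK 8≤K (K ─ Miss K x) (Miss K y)
            (shrink chordal free clK 8≤K K (Miss K x) 8≤K (miss-core x∈)) (miss-core y∈)
        R⊆K : R ⊆ K
        R⊆K = ─⊆ ∘ ─⊆
        K′ = (R ∪ ⁅ x ⁆) ∪ ⁅ y ⁆
        clK′ : Clique K′
        clK′ = clique-∪ (clique-∪ (λ i j → clK (R⊆K i) (R⊆K j)) (λ i → hit (R⊆K i) (─∉ (─⊆ i))))
          λ i → [ (λ j → hit (R⊆K j) (─∉ j)) , (λ j → subst (y ~_) (sym (⁅⁆⁻ j)) (~-sym x~y)) ] (∪⁻ i)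
        e-miss : ∣ Miss K′ e ∣ ≤ 2
        e-miss = miss≤2 chordal free clK′ (∪ˡ (∪ʳ ⁅⁆⁺)) (∪ʳ ⁅⁆⁺) (~⇒≢ x~y) e~x e~y
      ... | p , q , p∈ , q∈ , p≢q = no-two e∈ (─⊆ (─⊆ (─⊆ p∈))) (─⊆ (─⊆ (─⊆ q∈))) p≢q
          (hit (∪ˡ (∪ˡ (─⊆ p∈))) (─∉ p∈)) (hit (∪ˡ (∪ˡ (─⊆ q∈))) (─∉ q∈))

      -- If x and y are not adjacent, `fan` gives a vertex of E adjacent to their common neighbours
      -- in K, of which there are two. If they are adjacent, `fan` from a neighbour of x in E to y
      -- gives a vertex of E adjacent to both, against `edge-case`.
      one-contact : ∀ {x y} → x ∈ Core → y ∈ Core → Touches x E → Touches y E → x ≡ y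
      one-contact {x} {y} x∈ y∈ tx@(e , e∈ , x~e) ty with x Fin.≟ y
      ... | yes x≡y = x≡y
      ... | no x≢y with x ~? y
      ...   | no ¬x~y = ⊥-elim (far (fan chordal con x≢y ¬x~y (λ i → E∩Core i y∈) (inj₂ tx) ty)
                                  (common chordal free clK 8≤K (miss-core x∈) (miss-core y∈)
                                      (miss-core y∈)))
        where
        far : ∃[ e ] (e ∈ E × e ~ y × (∀ {p} → p ∉ E → p ~ x → p ~ y → p ~ e)) →
              ∃[ p ] ∃[ q ] (p ∈ K × q ∈ K × p ≢ q × (x ~ p × y ~ p × y ~ p) ×
                  (x ~ q × y ~ q × y ~ q)) → Absurd
        far (e , e∈ , _ , all) (p , q , p∈ , q∈ , p≢q , (x~p , y~p , _) , (x~q , y~q , _)) =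
          no-two e∈ p∈ q∈ p≢q (to p∈ x~p y~p) (to q∈ x~q y~q)
          where
          to : ∀ {p} → p ∈ K → x ~ p → y ~ p → e ~ p
          to p∈ x~p y~p = ~-sym (all (λ i → E∩Core i (K⊆Core p∈)) (~-sym x~p) (~-sym y~p))
      ...   | yes x~y with e ~? y
      ...     | yes e~y = ⊥-elim (edge-case x∈ y∈ x~y e∈ (~-sym x~e) e~y)
      ...     | no ¬e~y with fan chordal con (λ { refl → E∩Core e∈ y∈ }) ¬e~y (λ i → E∩Core i y∈)
          (inj₁ e∈) ty
      ...       | e′ , e′∈ , e′~y , all = ⊥-elim (edge-case x∈ y∈ x~y e′∈
          (~-sym (all (λ i → E∩Core i x∈) x~e x~y)) e′~y)

  open Recursion chordal {8} {16} (m≤m+n 8 8) ⊤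

  big : Step
  big {C} {Q} {v} clQ _ _ disj ∣Q∣≡8 v∈ v~ ih with extend-clique {U = Q ∪ C} clQ ∪ˡ
  ... | K , clK , Q⊆K , K⊆U , maximal = by (nonempty? (U ─ core))
    where
    U = Q ∪ C
    8≤K : 8 ≤ ∣ K ∣
    8≤K = ≤-trans (≤-reflexive (sym ∣Q∣≡8)) (∣∣-mono Q⊆K)
    core = Core clK 8≤K K⊆U
    -- This makes a component outside the core strictly smaller than C, so the induction hypothesis
    -- covers it.
    v∈core : v ∈ core
    v∈core with pick₂ Q (≤-trans (s≤s (s≤s z≤n)) (≤-reflexive (sym ∣Q∣≡8)))
    ... | p , q , p∈ , q∈ , p≢q = ⟨⟩⁺ (∪ʳ v∈ , p , q , Q⊆K p∈ , Q⊆K q∈ , p≢q , v~ p∈ , v~ q∈)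

    by : Dec (∃[ e ] e ∈ U ─ core) → Decomp 16 (Q ∪ C) C
    by (no all-core) = dense chordal free clK 8≤K K⊆U
      (λ {u} u∈ → miss-core clK 8≤K K⊆U (decidable-stable (u ∈? core) λ u∉ → all-core (u , ─⁺ u∈ u∉)))
      maximal (≤-reflexive ∣Q∣≡8) ∪ʳ λ x∈ x∉Q → [ (λ x∈Q → contradiction x∈Q x∉Q) , id ] (∪⁻ x∈)
    by (yes (e , e∈)) with component e∈
    ... | E , E⊆ , e∈E , con , closed = hang (any? λ z → (z ∈? core) ×-dec touches? chordal z E)
      where
      E∩core : Disjoint E core
      E∩core = ─∉ ∘ E⊆
      E⊆U : E ⊆ U
      E⊆U = ─⊆ ∘ E⊆
      E⊆C : E ⊆ C
      E⊆C x∈ = [ (λ x∈Q → contradiction (K⊆Core clK 8≤K K⊆U (Q⊆K x∈Q)) (E∩core x∈)) , id ] (∪⁻ (E⊆U x∈))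
      boundary : ∀ {x y} → x ∈ E → y ∈ U → y ∉ E → x ~ y → y ∈ core
      boundary {x} {y} x∈ y∈ y∉ x~y = decidable-stable (y ∈? core) λ y∉core →
          y∉ (closed x∈ (─⁺ y∈ y∉core) x~y)
      rest : Decomp 16 (Q ∪ (C ─ E)) (C ─ E)
      rest = ih (∣∣-mono-< ─⊆ (E⊆C e∈E) (λ i → ─∉ i e∈E)) clQ (λ _ → ∈⊤) (λ _ → ∈⊤) (disj ∘ ─⊆)
          (≤-reflexive ∣Q∣≡8)
      E<C : ∣ E ∣ < ∣ C ∣
      E<C = ∣∣-mono-< E⊆C v∈ (λ v∈E → E∩core v∈E v∈core)
      split : ∀ {x} → x ∈ C → x ∈ C ─ E ⊎ x ∈ E
      split {x} x∈ with x ∈? E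
      ... | yes x∈E = inj₂ x∈E
      ... | no x∉E = inj₁ (─⁺ x∈ x∉E)

      alone : Decomp 16 U E → (∀ {x y} → x ∈ C → y ∈ E → x ~ y → x ∈ E) → Decomp 16 U C
      alone DE apart = node (lift rest near) DE (λ x∈ → ─∉ x∈) ─⊆ E⊆C split
          (attached (≤-reflexive ∣Q∣≡8))
        where
        near : ∀ {x y} → x ∈ C ─ E → y ∈ Q ∪ C → x ~ y → y ∈ Q ∪ (C ─ E)
        near x∈ y∈ x~y = [ ∪ˡ , (λ y∈C → ∪ʳ (─⁺ y∈C λ y∈E → ─∉ x∈ (apart (─⊆ x∈) y∈E x~y))) ] (∪⁻ y∈)

      hang : Dec (∃[ z ] (z ∈ core × Touches z E)) → Decomp 16 (Q ∪ C) C
      hang (no untouched) = alone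
        (lift (ih E<C (λ x∈ → ⊥-elim (∉⊥ x∈)) (λ _ → ∈⊤) (λ _ → ∈⊤) (λ _ → ∉⊥)
            (≤-trans (≤-reflexive (∣⊥∣≡0 (n G))) z≤n))
          λ x∈ y∈ x~y → ∪ʳ (sealed x∈ y∈ x~y))
        λ x∈ y∈ x~y → sealed y∈ (∪ʳ x∈) (~-sym x~y)
        where
        sealed : ∀ {x y} → x ∈ E → y ∈ U → x ~ y → y ∈ E
        sealed {x} {y} x∈ y∈ x~y = decidable-stable (y ∈? E) λ y∉ →
            untouched (y , boundary x∈ y∈ y∉ x~y , x , x∈ , ~-sym x~y)
      -- If the only contact z lies in Q, then E is a separate branch beside the rest of C; if z
      -- lies in C, then E is hung onto z inside the decomposition of the rest.
      hang (yes (z , z∈core , tz)) = [ at-Q , at-C ] (∪⁻ (proj₁ (⟨⟩⁻ z∈core)))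
        where
        z∉E : z ∉ E
        z∉E z∈E = E∩core z∈E z∈core
        only : ∀ {x y} → x ∈ E → y ∈ U → y ∉ E → x ~ y → y ≡ z
        only x∈ y∈ y∉ x~y = one-contact clK 8≤K K⊆U con E⊆U E∩core (boundary x∈ y∈ y∉ x~y) z∈core
            (_ , x∈ , ~-sym x~y) tz
        DE : Decomp 16 U E
        DE = lift (ih E<C (λ x∈ y∈ x≢y → contradiction (trans (⁅⁆⁻ x∈) (sym (⁅⁆⁻ y∈))) x≢y)
            (λ _ → ∈⊤) (λ _ → ∈⊤)
                     (λ x∈ x∈z → z∉E (subst (_∈ E) (⁅⁆⁻ x∈z) x∈))
                         (≤-trans (≤-reflexive (∣⁅⁆∣ z)) (s≤s z≤n))) near
          where
          near : ∀ {x y} → x ∈ E → y ∈ U → x ~ y → y ∈ ⁅ z ⁆ ∪ E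
          near {x} {y} x∈ y∈ x~y with y ∈? E
          ... | yes y∈E = ∪ʳ y∈E
          ... | no y∉E = ∪ˡ (subst (_∈ ⁅ z ⁆) (sym (only x∈ y∈ y∉E x~y)) ⁅⁆⁺)
        at-Q : z ∈ Q → Decomp 16 U C
        at-Q z∈Q = alone DE λ {x} x∈ y∈ x~y → decidable-stable (x ∈? E) λ x∉ →
          disj x∈ (subst (_∈ Q) (sym (only y∈ (∪ʳ x∈) x∉ (~-sym x~y))) z∈Q)
        at-C : z ∈ C → Decomp 16 U C
        at-C z∈C = prune (lift rest near) (∪ʳ ∘ ─⊆) ─∉ only DE (─⁺ z∈C z∉E) ─⊆ E⊆C split
          where
          near : ∀ {x y} → x ∈ C ─ E → y ∈ U ─ E → x ~ y → y ∈ Q ∪ (C ─ E)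
          near x∈ y∈ _ = [ ∪ˡ , (λ y∈C → ∪ʳ (─⁺ y∈C (─∉ y∈))) ] (∪⁻ (─⊆ y∈))

  decomposition : Decomp 16 ⊤ ⊤
  decomposition = lift
    (decompose big (suc ∣ ⊤ {n G} ∣) (n<1+n _) (λ x∈ → ⊥-elim (∉⊥ x∈)) (λ _ → ∈⊤) (λ _ → ∈⊤) (λ _ → ∉⊥)
      (≤-trans (≤-reflexive (∣⊥∣≡0 (n G))) z≤n)) λ _ _ _ → ∪ʳ ∈⊤

theorem3 : Σ ℕ λ c → (G : Graph) → Chordal G → Free 6 coClaw2P1Adj G → CWAtMost c G
-- The constant is 3 * 2 ^ 17: three zones, 16 bits, and one bit for `live`.
theorem3 = _ , λ G chordal free → Decomposition.decomp⇒cw G (Main.decomposition G chordal free)
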